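{- For every $r\geq 3$ there exists a quasi-linear, inconsistent $r$-graph $F$ which admits all inconsistent descriptive sequences of order $r$.
   Context: An $r$-graph is an $r$-uniform hypergraph. A hypergraph $H$ is quasi-linear if for every edge $e$ there is a unique other edge $f$ (its twin) with $|e\cap f|=2$, and every edge $f'\notin\{e,f\}$ satisfies $|e\cap f'|\leq1$. Roles: given a linearly ordered set $S$ of $k$ elements sorted as $w_1\prec\dots\prec w_k$, a pair $\{u,v\}\subseteq S$ plays the role $\{i,j\}\in\binom{[k]}{2}$ in $S$ if $\{w_i,w_j\}=\{u,v\}$. A quasi-linear hypergraph with a linear vertex order is consistently ordered if for every twin pair $\{e,f\}$, the pair $e\cap f$ plays the same role in $e$ as in $f$. It is consistent if some vertex order makes it consistently ordered, and inconsistent otherwise. A descriptive sequence of order $k$ is a sequence $\sigma=(s_1,\dots,s_{2k-2})$ over $\{X,Y,Z\}$ with exactly $k-2$ letters $X$, $k-2$ letters $Y$ and two letters $Z$. It is consistent if the pair of $Z$-positions plays the same role among the $k$ positions carrying $X$ or $Z$ as among the $k$ positions carrying $Y$ or $Z$, and inconsistent otherwise. Given a linearly ordered vertex set and two $k$-edges $e,f$ with $|e\cap f|=2$, sort $e\cup f$ as $w_1\prec\dots\prec w_{2k-2}$; $\sigma$ describes $\{e,f\}$ if either ($s_i=X$ iff $w_i\in e\setminus f$, $s_i=Y$ iff $w_i\in f\setminus e$, $s_i=Z$ iff $w_i\in e\cap f$) or the same holds with $e,f$ swapped. A quasi-linear hypergraph admits $\sigma$ if there is a linear order of its vertex set in which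 every twin pair of edges is described by $\sigma$. -}

module Defs where

open import Data.Nat using (ℕ; zero; suc; _+_; _∸_; _*_; _≤_; _<_; _⊔_; _⊓_)
open import Data.Nat.Properties using (_<?_)
open import Data.Bool using (Bool; true; false)
open import Data.Fin using (Fin; toℕ)
open import Data.Fin.Subset using (Subset; _∈_; _∉_; _∩_; _∪_; ∣_∣)
open import Data.Fin.Permutation using (Permutation′; _⟨$⟩ʳ_)
open import Data.Vec using (tabulate)
open import Data.List using (List; []; _∷_; length; take)
open import Data.Maybe using (Maybe; just; nothing)
open import Data.Product using (_×_; _,_; Σ; ∃)
open import Data.Sum using (_⊎_)
open import Relation.Nullary using (¬_)
open import Relation.Nullary.Decidable using (⌊_⌋)
open import Relation.Binary.PropositionalEquality using (_≡_; _≢_)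

record Hypergraph (r : ℕ) : Set where
  field
    n        : ℕ
    m        : ℕ
    edge     : Fin m → Subset n
    uniform  : ∀ i → ∣ edge i ∣ ≡ r
    distinct : ∀ i j → edge i ≡ edge j → i ≡ j

open Hypergraph public

QuasiLinear : ∀ {r} → Hypergraph r → Set
QuasiLinear H = ∀ e → Σ (Fin (m H)) λ f →
    (e ≢ f) × (∣ edge H e ∩ edge H f ∣ ≡ 2)
  × (∀ f′ → f′ ≢ e → f′ ≢ f → ∣ edge H e ∩ edge H f′ ∣ ≤ 1)

-- Linear orders on the vertex set Fin n are given by permutations π:
-- u ≺ v  iff  toℕ (π ⟨$⟩ʳ u) < toℕ (π ⟨$⟩ʳ v).

Order : ℕ → Set
Order n = Permutation′ n

rank : ∀ {n} → Order n → Fin n → ℕ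
rank π u = toℕ (π ⟨$⟩ʳ u)

below : ∀ {n} → Order n → Fin n → Subset n
below π u = tabulate (λ w → ⌊ rank π w <? rank π u ⌋)

pos : ∀ {n} → Order n → Subset n → Fin n → ℕ
pos π S u = ∣ S ∩ below π u ∣

role : ∀ {n} → Order n → Subset n → Fin n → Fin n → ℕ × ℕ
role π S u v = (pos π S u ⊓ pos π S v , pos π S u ⊔ pos π S v)

ConsistentlyOrdered : ∀ {r} (H : Hypergraph r) → Order (n H) → Set
ConsistentlyOrdered H π = ∀ e f → e ≢ f → ∣ edge H e ∩ edge H f ∣ ≡ 2 →
  ∀ u v → u ≢ v → u ∈ (edge H e ∩ edge H f) → v ∈ (edge H e ∩ edge H f) →
  role π (edge H e) u v ≡ role π (edge H f) u v

Consistent : ∀ {r} → Hypergraph r → Set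
Consistent H = ∃ λ π → ConsistentlyOrdered H π

Inconsistent : ∀ {r} → Hypergraph r → Set
Inconsistent H = ¬ Consistent H

data Letter : Set where
  X Y Z : Letter

count : (Letter → Bool) → List Letter → ℕ
count p []      = 0
count p (a ∷ σ) with p a
... | true  = suc (count p σ)
... | false = count p σ

isX isY isZ isXZ isYZ : Letter → Bool
isX X = true
isX _ = false
isY Y = true
isY _ = false
isZ Z = true
isZ _ = false
isXZ Y = false
isXZ _ = true
isYZ X = false
isYZ _ = true

_!!_ : List Letter → ℕ → Maybe Letter
[]      !! _     = nothing
(a ∷ σ) !! zero  = just a
(a ∷ σ) !! suc i = σ !! i

DescriptiveSeq : ℕ → List Letter → Set
DescriptiveSeq k σ = (length σ ≡ 2 * k ∸ 2) × (count isX σ ≡ k ∸ 2)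
  × (count isY σ ≡ k ∸ 2) × (count isZ σ ≡ 2)

rankXZ rankYZ : List Letter → ℕ → ℕ
rankXZ σ p = count isXZ (take p σ)
rankYZ σ p = count isYZ (take p σ)

ConsistentSeq : List Letter → Set
ConsistentSeq σ = ∀ p q → p < q → σ !! p ≡ just Z → σ !! q ≡ just Z →
  (rankXZ σ p , rankXZ σ q) ≡ (rankYZ σ p , rankYZ σ q)

InconsistentSeq : List Letter → Set
InconsistentSeq σ = ¬ ConsistentSeq σ

LabelOf : ∀ {n} → Subset n → Subset n → Fin n → Letter → Set
LabelOf e f w X = (w ∈ e) × (w ∉ f)
LabelOf e f w Y = (w ∉ e) × (w ∈ f)
LabelOf e f w Z = (w ∈ e) × (w ∈ f)

DescribesOrdered : ∀ {n} → Order n → List Letter → Subset n → Subset n → Set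
DescribesOrdered π σ e f = ∀ w → w ∈ (e ∪ f) →
  Σ Letter λ s → (σ !! pos π (e ∪ f) w ≡ just s) × LabelOf e f w s

Describes : ∀ {n} → Order n → List Letter → Subset n → Subset n → Set
Describes π σ e f = DescribesOrdered π σ e f ⊎ DescribesOrdered π σ f e

Admits : ∀ {r} → Hypergraph r → List Letter → Set
Admits H σ = ∃ λ (π : Order (n H)) → ∀ e f → e ≢ f →
  ∣ edge H e ∩ edge H f ∣ ≡ 2 → Describes π σ (edge H e) (edge H f)

{-# OPTIONS --safe #-}
-- A unit is a twin pair on 2r − 2 vertices, each vertex carrying a letter X, Y or Z. Take one coordinate for
-- every inconsistent sequence σ and, in a finite grid, units whose vertices are arranged in each coordinate
-- as the corresponding σ prescribes, up to exchanging X with Y; sorting by a coordinate then admits σ.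
--
-- Suppose some order of the grid makes every unit consistent. Moving one X-vertex x of a unit while the rest
-- stays put cannot change the side of a Z-vertex z on which x lies. As an inconsistent σ has letters other
-- than Z both before and after some Z, this applies in every direction, so whether u precedes v depends only
-- on the sign vector of v − u. By transitivity such an order is given by a single coordinate or its reverse,
-- in which units are inconsistent, a contradiction.
--
-- To make the units almost disjoint, place copies of the grid along the lines h = a v + b over its points v,
-- with a, b < s: two distinct copies meet in at most one vertex. Each copy keeps a single unit. Every order has
-- a bad unit in each copy, so a popular unit is bad for a fixed fraction of the orders not yet refuted;
-- the s² copies refute all orders, as there are only exp(O(s log s)) of them.

module Submission where

open import Defs
open import Data.Bool using (Bool; true; false; _∧_; not; if_then_else_)
open import Data.Bool.Properties using (T-≡; ∧-zeroʳ; ∧-identityʳ; not-injective; not-¬; ¬-not)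
import Data.Bool.Properties as Bool
open import Data.Fin using (Fin; zero; suc; toℕ; fromℕ<; punchIn; punchOut; combine; remQuot; finToFun; funToFin)
open import Data.Fin.Permutation using (Permutation; Permutation′; permutation; _⟨$⟩ʳ_; _⟨$⟩ˡ_; inverseʳ; insert; insert-punchIn)
import Data.Fin.Permutation as Perm
import Data.Fin.Properties as Fin
open import Data.Fin.Subset using (Subset; _∈_; _∉_; _∩_; _∪_; ∣_∣; ⁅_⁆; inside; outside)
open import Data.Fin.Subset.Properties
  using (Empty-unique; ∣⊥∣≡0; ∣⁅x⁆∣≡1; p⊆q⇒∣p∣≤∣q∣; x∈⁅x⁆; nonempty?; ∩-comm; ∩-idem; x∈p∩q⁺; x∈p∩q⁻; x∈p∪q⁺; x∈p∪q⁻)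
open import Data.List using (List; []; _∷_; _++_; length; lookup; take; replicate; filter; cartesianProductWith)
import Data.List.Membership.Propositional as List
open import Data.List.Membership.Propositional.Properties using (∈-cartesianProductWith⁺; ∈-filter⁺; ∈-filter⁻; ∈-lookup)
open import Data.List.Properties using (length-++; length-replicate)
open import Data.List.Relation.Unary.Any using (index; here; there)
open import Data.List.Relation.Unary.Any.Properties using (lookup-index)
open import Data.Maybe using (just)
open import Data.Nat using (ℕ; zero; suc; _+_; _*_; _∸_; _^_; _≤_; _<_; _<ᵇ_; _⊔_; _⊓_; z≤n; s≤s; z<s)
open import Data.Nat.Properties
open import Data.Nat.Solver using (module +-*-Solver)
open import Data.Product using (Σ; ∃; ∃₂; _×_; _,_; proj₁; proj₂)
open import Data.Sum using (_⊎_; inj₁; inj₂)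
import Data.Vec as Vec
import Data.Vec.Properties as Vec
open import Data.Vec using (_[_]≔_)
open import Function using (_∘_; Equivalence; Injective)
open import Relation.Binary.Definitions using (tri<; tri≈; tri>)
open import Relation.Binary.PropositionalEquality
open import Relation.Nullary using (¬_; Dec; yes; no; contradiction)
open import Relation.Nullary.Decidable using (⌊_⌋; _×-dec_; _→-dec_; ¬?; decidable-stable)
open import Algebra.Properties.CommutativeMonoid.Sum +-0-commutativeMonoid
  using (sum; sum-cong-≗; sum-permute; ∑-distrib-+; ∑-comm; sum-remove)

-- Counting, cardinalities and sorting.

𝟙 : Bool → ℕ
𝟙 false = 0
𝟙 true  = 1

cnt : ∀ {n} → (Fin n → Bool) → ℕ
cnt f = sum (λ i → 𝟙 (f i))

cnt-cong : ∀ {n} {f g : Fin n → Bool} → (∀ i → f i ≡ g i) → cnt f ≡ cnt g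
cnt-cong f≗g = sum-cong-≗ (λ i → cong 𝟙 (f≗g i))

cnt-permute : ∀ {m n} (f : Fin n → Bool) (π : Permutation m n) → cnt (λ i → f (π ⟨$⟩ʳ i)) ≡ cnt f
cnt-permute f π = sym (sum-permute (λ i → 𝟙 (f i)) π)

cnt-false : ∀ n → cnt {n} (λ _ → false) ≡ 0
cnt-false zero    = refl
cnt-false (suc n) = cnt-false n

cnt-true : ∀ n → cnt {n} (λ _ → true) ≡ n
cnt-true zero    = refl
cnt-true (suc n) = cong suc (cnt-true n)

cnt-+ : ∀ {n} (f g h : Fin n → Bool) → (∀ i → 𝟙 (f i) ≡ 𝟙 (g i) + 𝟙 (h i)) → cnt f ≡ cnt g + cnt h
cnt-+ f g h eq = trans (sum-cong-≗ eq) (∑-distrib-+ (λ i → 𝟙 (g i)) (λ i → 𝟙 (h i)))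

cnt-mono : ∀ {n} {f g : Fin n → Bool} → (∀ i → f i ≡ true → g i ≡ true) → cnt f ≤ cnt g
cnt-mono {zero}          f⇒g = z≤n
cnt-mono {suc n} {f} {g} f⇒g = +-mono-≤ (at0 (f⇒g zero)) (cnt-mono (λ i → f⇒g (suc i)))
  where
  at0 : ∀ {a b} → (a ≡ true → b ≡ true) → 𝟙 a ≤ 𝟙 b
  at0 {false} _ = z≤n
  at0 {true}  h rewrite h refl = ≤-refl

cnt-mono-< : ∀ {n} {f g : Fin n → Bool} → (∀ i → f i ≡ true → g i ≡ true) →
             ∀ i → f i ≡ false → g i ≡ true → cnt f < cnt g
cnt-mono-< {suc n} {f} {g} f⇒g i fi gi
  rewrite sum-remove {i = i} (λ j → 𝟙 (f j)) | sum-remove {i = i} (λ j → 𝟙 (g j)) | fi | gi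
  = s≤s (cnt-mono {f = λ j → f (punchIn i j)} (λ j → f⇒g (punchIn i j)))

cnt-<ᵇ : ∀ {n} (s : Fin n) → cnt (λ (i : Fin n) → toℕ i <ᵇ toℕ s) ≡ toℕ s
cnt-<ᵇ {suc n} zero    = cnt-false n
cnt-<ᵇ {suc n} (suc s) = cong suc (cnt-<ᵇ s)

<ᵇ-true : ∀ {a b} → a < b → (a <ᵇ b) ≡ true
<ᵇ-true a<b = Equivalence.to T-≡ (<⇒<ᵇ a<b)

<ᵇ-true⁻ : ∀ {a b} → (a <ᵇ b) ≡ true → a < b
<ᵇ-true⁻ {a} {b} eq = <ᵇ⇒< a b (Equivalence.from T-≡ eq)

<ᵇ-false : ∀ {a b} → b ≤ a → (a <ᵇ b) ≡ false
<ᵇ-false {a} {b} b≤a with a <ᵇ b in eq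
... | false = refl
... | true  = contradiction (<ᵇ-true⁻ {a} eq) (≤⇒≯ b≤a)

∣update∣ : ∀ {n} (S : Subset n) x → x ∈ S → ∣ S ∣ ≡ suc ∣ S [ x ]≔ outside ∣
∣update∣ (.inside Vec.∷ S) zero    Vec.here       = refl
∣update∣ (inside  Vec.∷ S) (suc x) (Vec.there x∈) = cong suc (∣update∣ S x x∈)
∣update∣ (outside Vec.∷ S) (suc x) (Vec.there x∈) = ∣update∣ S x x∈

∈-update⁺ : ∀ {n} {S : Subset n} {x w} → w ≢ x → w ∈ S → w ∈ S [ x ]≔ outside
∈-update⁺ {x = zero}  w≢x Vec.here       = contradiction refl w≢x
∈-update⁺ {x = suc x} w≢x Vec.here       = Vec.here
∈-update⁺ {x = zero}  w≢x (Vec.there w∈) = Vec.there w∈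
∈-update⁺ {x = suc x} w≢x (Vec.there w∈) = Vec.there (∈-update⁺ (w≢x ∘ cong suc) w∈)

∈-update⁻ : ∀ {n} (S : Subset n) x {w} → w ∈ S [ x ]≔ outside → w ≢ x × w ∈ S
∈-update⁻ (s Vec.∷ S) zero    (Vec.there w∈) = (λ ()) , Vec.there w∈
∈-update⁻ (s Vec.∷ S) (suc x) Vec.here       = (λ ()) , Vec.here
∈-update⁻ (s Vec.∷ S) (suc x) (Vec.there w∈) with ∈-update⁻ S x w∈
... | w≢x , w∈S = (λ { refl → w≢x refl }) , Vec.there w∈S

-- The cardinalities of edges, twin intersections and initial segments become counts over the
-- vertices of one unit in this way. Induction on the domain: when index 0 is selected, its image
-- leaves `S`, and injectivity keeps the later images inside.
card-image : ∀ {k n} (u : Fin k → Fin n) → Injective _≡_ _≡_ u → (Q : Fin k → Bool) (S : Subset n) →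
  (∀ {w} → w ∈ S → ∃ λ p → Q p ≡ true × u p ≡ w) → (∀ p → Q p ≡ true → u p ∈ S) → ∣ S ∣ ≡ cnt Q
card-image {zero} {n} u inj Q S S⊆ ⊆S
  rewrite Empty-unique {p = S} (λ (w , w∈) → contradiction (proj₁ (S⊆ w∈)) λ ()) = ∣⊥∣≡0 n
card-image {suc k} u inj Q S S⊆ ⊆S with Q zero in eq
... | false = card-image (u ∘ suc) (Fin.suc-injective ∘ inj) (Q ∘ suc) S S⊆′ (λ p → ⊆S (suc p))
  where
  S⊆′ : ∀ {w} → w ∈ S → ∃ λ p → Q (suc p) ≡ true × u (suc p) ≡ w
  S⊆′ w∈ with S⊆ w∈
  ... | zero  , q , _ = contradiction (trans (sym eq) q) λ ()
  ... | suc p , q , e = p , q , e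
... | true = trans (∣update∣ S (u zero) (⊆S zero eq))
                   (cong suc (card-image (u ∘ suc) (Fin.suc-injective ∘ inj) (Q ∘ suc) _ S⊆′
                     (λ p q → ∈-update⁺ (λ e → contradiction (inj e) λ ()) (⊆S (suc p) q))))
  where
  S⊆′ : ∀ {w} → w ∈ S [ u zero ]≔ outside → ∃ λ p → Q (suc p) ≡ true × u (suc p) ≡ w
  S⊆′ w∈ with ∈-update⁻ S (u zero) w∈
  ... | w≢u0 , w∈S with S⊆ w∈S
  ... | zero  , _ , e = contradiction (sym e) w≢u0
  ... | suc p , q , e = p , q , e

injective⇒permutation : ∀ {n} (f : Fin n → Fin n) → Injective _≡_ _≡_ f →
  Σ (Permutation′ n) λ π → ∀ i → π ⟨$⟩ʳ i ≡ f i
injective⇒permutation {n} f inj =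
  permutation f (proj₁ ∘ onto) (proj₂ ∘ onto) (λ i → inj (proj₂ (onto (f i)))) , λ _ → refl
  where
  surj : ∀ {n} (g : Fin n → Fin n) → Injective _≡_ _≡_ g → ∀ y → ∃ λ x → g x ≡ y
  surj {suc n} g g-inj y with Fin.any? (λ x → g x Fin.≟ y)
  ... | yes found = found
  -- If `g` missed `y`, punching `y` out of its values would give an injection from `Fin (suc n)`
  -- into `Fin n`.
  ... | no  none  = contradiction
    (λ {i j} e → g-inj (Fin.punchOut-injective (λ y≡ → none (i , sym y≡)) (λ y≡ → none (j , sym y≡)) e))
    (Fin.<⇒notInjective {f = λ x → punchOut {i = y} {j = g x} (λ y≡ → none (x , sym y≡))} ≤-refl)

  onto : ∀ y → ∃ λ x → f x ≡ y
  onto = surj f inj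

-- An element is sent to the number of elements with a smaller key; these numbers are below `n`, and
-- distinct since they grow strictly with the key.
sort : ∀ {n} (key : Fin n → ℕ) → Injective _≡_ _≡_ key →
  Σ (Permutation′ n) λ π → ∀ v w → key v < key w → toℕ (π ⟨$⟩ʳ v) < toℕ (π ⟨$⟩ʳ w)
sort {n} key key-inj = proj₁ sorted , λ v w v<w →
  subst₂ (λ a b → toℕ a < toℕ b) (sym (proj₂ sorted v)) (sym (proj₂ sorted w)) (rk-mono v<w)
  where
  #below : Fin n → ℕ
  #below w = cnt (λ v → key v <ᵇ key w)

  #below-mono : ∀ {v w} → key v < key w → #below v < #below w
  #below-mono {v} {w} v<w = cnt-mono-<
    (λ i i<v → <ᵇ-true (<-trans (<ᵇ-true⁻ {key i} i<v) v<w))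
    v (<ᵇ-false {key v} ≤-refl) (<ᵇ-true v<w)

  #below<n : ∀ w → #below w < n
  #below<n w = subst (#below w <_) (cnt-true n) (cnt-mono-< (λ _ _ → refl) w (<ᵇ-false {key w} ≤-refl) refl)

  rk : Fin n → Fin n
  rk w = fromℕ< (#below<n w)

  rk-mono : ∀ {v w} → key v < key w → toℕ (rk v) < toℕ (rk w)
  rk-mono {v} {w} v<w rewrite Fin.toℕ-fromℕ< (#below<n v) | Fin.toℕ-fromℕ< (#below<n w) = #below-mono v<w

  rk-inj : Injective _≡_ _≡_ rk
  rk-inj {v} {w} e with <-cmp (key v) (key w)
  ... | tri< v<w _ _ = contradiction (cong toℕ e) (<⇒≢ (rk-mono v<w))
  ... | tri≈ _ v≡w _ = key-inj v≡w
  ... | tri> _ _ w<v = contradiction (cong toℕ (sym e)) (<⇒≢ (rk-mono w<v))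

  sorted = injective⇒permutation rk rk-inj

-- Greedy choice

max-term : ∀ M (c : Fin (suc M) → ℕ) → ∃ λ i → sum c ≤ suc M * c i
max-term zero    c = zero , ≤-refl
max-term (suc M) c with max-term M (c ∘ suc)
... | i , le with ≤-total (c zero) (c (suc i))
... | inj₁ c₀≤ = suc i , +-mono-≤ c₀≤ le
... | inj₂ c₀≥ = zero , +-monoʳ-≤ (c zero) (≤-trans le (*-monoʳ-≤ (suc M) c₀≥))

cnt-∧-≟ : ∀ {M} b (x : Fin M) → cnt (λ i → b ∧ ⌊ x Fin.≟ i ⌋) ≡ 𝟙 b
cnt-∧-≟ {M} false x = cnt-false M
cnt-∧-≟ {suc M} true x rewrite sum-remove {i = x} (λ i → 𝟙 ⌊ x Fin.≟ i ⌋) with x Fin.≟ x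
... | no x≢x = contradiction refl x≢x
... | yes _  = cong suc (trans (cnt-cong (λ i → off (Fin.punchInᵢ≢i x i))) (cnt-false M))
  where
  off : ∀ {y} → y ≢ x → ⌊ x Fin.≟ y ⌋ ≡ false
  off {y} y≢x with x Fin.≟ y
  ... | yes x≡y = contradiction (sym x≡y) y≢x
  ... | no _    = refl

-- Averaging: every alive `o` hits exactly one of the `suc M` options, so some option collects a
-- share of at least 1 / (M + 1), and at most M / (M + 1) of them survive. The bound has its
-- denominators cleared.
popular : ∀ {n M} (alive : Fin n → Bool) (w : Fin n → Fin (suc M)) →
  ∃ λ i → cnt (λ o → alive o ∧ not ⌊ w o Fin.≟ i ⌋) * suc M ≤ cnt alive * M
popular {n} {M} alive w = i , (begin
  b * suc M                                        ≡⟨ m+n∸n≡m (b * suc M) (suc M * a) ⟨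
  (b * suc M + suc M * a) ∸ suc M * a              ≤⟨ ∸-monoʳ-≤ (b * suc M + suc M * a) l≤ ⟩
  (b * suc M + suc M * a) ∸ cnt alive              ≡⟨ cong (_∸ cnt alive) (trans rearr (cong (λ x → x + x * M) (sym split))) ⟩
  (cnt alive + cnt alive * M) ∸ cnt alive          ≡⟨ m+n∸m≡n (cnt alive) _ ⟩
  cnt alive * M                                    ∎)
  where
  open ≤-Reasoning
  hits : Fin (suc M) → ℕ
  hits i = cnt (λ o → alive o ∧ ⌊ w o Fin.≟ i ⌋)
  best = max-term M hits
  i = proj₁ best
  a = hits i
  b = cnt (λ o → alive o ∧ not ⌊ w o Fin.≟ i ⌋)
  total : sum hits ≡ cnt alive
  total = trans (∑-comm (λ i o → 𝟙 (alive o ∧ ⌊ w o Fin.≟ i ⌋))) (sum-cong-≗ (λ o → cnt-∧-≟ (alive o) (w o)))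
  l≤ : cnt alive ≤ suc M * a
  l≤ = subst (_≤ suc M * a) total (proj₂ best)
  split : cnt alive ≡ a + b
  split = cnt-+ alive _ _ (λ o → pointwise (alive o) ⌊ w o Fin.≟ i ⌋)
    where
    pointwise : ∀ x y → 𝟙 x ≡ 𝟙 (x ∧ y) + 𝟙 (x ∧ not y)
    pointwise false y     = refl
    pointwise true  false = refl
    pointwise true  true  = refl
  rearr : b * suc M + suc M * a ≡ (a + b) + (a + b) * M
  rearr = solve 3 (λ a b M → b :* (con 1 :+ M) :+ (con 1 :+ M) :* a := (a :+ b) :+ (a :+ b) :* M) refl a b M
    where open +-*-Solver

-- Each round leaves at most the fraction M / (M + 1) alive, so by the size hypothesis fewer than
-- one `o` is left after `Q` rounds. In use, `o` ranges over orders and φ over copies, `w o φ` is a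
-- unit of copy φ that is bad for `o`, and `A` selects the units.
greedy : ∀ {n} M Q (w : Fin n → Fin Q → Fin (suc M)) (alive : Fin n → Bool) →
  cnt alive * M ^ Q < suc M ^ Q →
  ∃ λ (A : Fin Q → Fin (suc M)) → ∀ o → alive o ≡ true → ∃ λ φ → w o φ ≡ A φ
greedy {n} M zero w alive small = (λ ()) , λ o al →
  contradiction (<-≤-trans small (none o al)) (<-irrefl refl)
  where
  none : ∀ o → alive o ≡ true → 1 ≤ cnt alive * 1
  none o al rewrite *-identityʳ (cnt alive) =
    subst (_< cnt alive) (cnt-false n) (cnt-mono-< {f = λ _ → false} (λ _ ()) o refl al)
greedy {n} M (suc Q) w alive small with popular alive (λ o → w o zero)
... | i , le with greedy M Q (λ o φ → w o (suc φ)) (λ o → alive o ∧ not ⌊ w o zero Fin.≟ i ⌋) small′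
  where
  open ≤-Reasoning
  small′ : cnt (λ o → alive o ∧ not ⌊ w o zero Fin.≟ i ⌋) * M ^ Q < suc M ^ Q
  small′ = *-cancelʳ-< (suc M) _ _ (begin-strict
    b * M ^ Q * suc M     ≡⟨ solve 3 (λ b x m → b :* x :* m := b :* m :* x) refl b (M ^ Q) (suc M) ⟩
    b * suc M * M ^ Q     ≤⟨ *-monoˡ-≤ (M ^ Q) le ⟩
    cnt alive * M * M ^ Q ≡⟨ *-assoc (cnt alive) M (M ^ Q) ⟩
    cnt alive * M ^ suc Q <⟨ small ⟩
    suc M ^ suc Q         ≡⟨ *-comm (suc M) (suc M ^ Q) ⟩
    suc M ^ Q * suc M     ∎)
    where
    open +-*-Solver
    b = cnt (λ o → alive o ∧ not ⌊ w o zero Fin.≟ i ⌋)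
... | A , hit = A′ , hit′
  where
  A′ : Fin (suc Q) → Fin (suc M)
  A′ zero    = i
  A′ (suc φ) = A φ
  hit′ : ∀ o → alive o ≡ true → ∃ λ φ → w o φ ≡ A′ φ
  hit′ o al with w o zero Fin.≟ i in eq
  ... | yes w≡i = zero , w≡i
  ... | no  w≢i with hit o (cong₂ (λ x y → x ∧ not ⌊ y ⌋) al eq)
  ... | φ , e = suc φ , e

-- Exponential estimates against the number of orders.

n<2^n : ∀ n → n < 2 ^ n
n<2^n zero    = z<s
n<2^n (suc n) = ≤-trans (+-mono-≤ (m^n>0 2 n) (n<2^n n)) (≤-reflexive (cong (2 ^ n +_) (sym (+-identityʳ (2 ^ n)))))

[m*n]^o≡m^o*n^o : ∀ m n o → (m * n) ^ o ≡ m ^ o * n ^ o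
[m*n]^o≡m^o*n^o m n zero    = refl
[m*n]^o≡m^o*n^o m n (suc o) rewrite [m*n]^o≡m^o*n^o m n o =
  solve 4 (λ m n x y → m :* n :* (x :* y) := m :* x :* (n :* y)) refl m n (m ^ o) (n ^ o)
  where open +-*-Solver

-- Bernoulli's inequality (1 + 1/a)^m ≥ 1 + m/a, multiplied by a^(m+1).
bernoulli : ∀ a m → (a + m) * a ^ m ≤ a * suc a ^ m
bernoulli a zero    = ≤-reflexive (cong (_* 1) (+-identityʳ a))
bernoulli a (suc m) = begin
  (a + suc m) * (a * a ^ m)         ≤⟨ m≤m+n _ (m * a ^ m) ⟩
  (a + suc m) * (a * a ^ m) + m * a ^ m
    ≡⟨ solve 3 (λ a m x → (a :+ (con 1 :+ m)) :* (a :* x) :+ m :* x := (con 1 :+ a) :* ((a :+ m) :* x)) refl a m (a ^ m) ⟩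
  suc a * ((a + m) * a ^ m)         ≤⟨ *-monoʳ-≤ (suc a) (bernoulli a m) ⟩
  suc a * (a * suc a ^ m)           ≡⟨ solve 3 (λ b a x → b :* (a :* x) := a :* (b :* x)) refl (suc a) a (suc a ^ m) ⟩
  a * (suc a * suc a ^ m)           ∎
  where
  open ≤-Reasoning
  open +-*-Solver

2*a^a≤[1+a]^a : ∀ a′ → let a = suc a′ in 2 * a ^ a ≤ suc a ^ a
2*a^a≤[1+a]^a a′ = *-cancelˡ-≤ a (begin
  a * (2 * a ^ a)   ≡⟨ solve 2 (λ a x → a :* (con 2 :* x) := (a :+ a) :* x) refl a (a ^ a) ⟩
  (a + a) * a ^ a   ≤⟨ bernoulli a a ⟩
  a * suc a ^ a     ∎)
  where
  open ≤-Reasoning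
  open +-*-Solver
  a = suc a′

-- A block of `a` factors (a + 1) / a is worth at least 2, and `Q` factors contain `L` such blocks;
-- the `e` factors left over are at least 1.
exp-gap : ∀ a′ L Q → let a = suc a′ in a * L ≤ Q → 2 ^ L * a ^ Q ≤ suc a ^ Q
exp-gap a′ L Q aL≤Q with e , refl ← m≤n⇒∃[o]m+o≡n aL≤Q = begin
  2 ^ L * a ^ (a * L + e)             ≡⟨ cong (2 ^ L *_) (^-distribˡ-+-* a (a * L) e) ⟩
  2 ^ L * (a ^ (a * L) * a ^ e)       ≡⟨ *-assoc (2 ^ L) (a ^ (a * L)) (a ^ e) ⟨
  2 ^ L * a ^ (a * L) * a ^ e         ≡⟨ cong (λ x → 2 ^ L * x * a ^ e) (^-*-assoc a a L) ⟨
  2 ^ L * (a ^ a) ^ L * a ^ e         ≡⟨ cong (_* a ^ e) ([m*n]^o≡m^o*n^o 2 (a ^ a) L) ⟨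
  (2 * a ^ a) ^ L * a ^ e             ≤⟨ *-mono-≤ (^-monoˡ-≤ L (2*a^a≤[1+a]^a a′)) (^-monoˡ-≤ e (n≤1+n a)) ⟩
  (suc a ^ a) ^ L * suc a ^ e         ≡⟨ cong (_* suc a ^ e) (^-*-assoc (suc a) a L) ⟩
  suc a ^ (a * L) * suc a ^ e         ≡⟨ ^-distribˡ-+-* (suc a) (a * L) e ⟨
  suc a ^ (a * L + e)                 ∎
  where
  open ≤-Reasoning
  a = suc a′

-- The left side is at most (1 + C)^3, and 1 + C ≤ 2^C. This settles the exponent `q = 3 * C` in the
-- choice of `s`.
2^3C≥ : ∀ C → C * (1 + 3 * C) ≤ 2 ^ (3 * C)
2^3C≥ C = begin
  C * (1 + 3 * C)                       ≤⟨ m≤m+n _ (C * C * C + 2 * C + 1) ⟩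
  C * (1 + 3 * C) + (C * C * C + 2 * C + 1)
    ≡⟨ solve 1 (λ C → C :* (con 1 :+ con 3 :* C) :+ (C :* C :* C :+ con 2 :* C :+ con 1)
         := (con 1 :+ C) :* ((con 1 :+ C) :* ((con 1 :+ C) :* con 1))) refl C ⟩
  suc C ^ 3                             ≤⟨ ^-monoˡ-≤ 3 (n<2^n C) ⟩
  (2 ^ C) ^ 3                           ≡⟨ ^-*-assoc 2 C 3 ⟩
  2 ^ (C * 3)                           ≡⟨ cong (2 ^_) (*-comm C 3) ⟩
  2 ^ (3 * C)                           ∎
  where
  open ≤-Reasoning
  open +-*-Solver

-- ν^ν bounds the number of orders of the blow-up, s² is its number of copies.
few-orders : ∀ K a → ∃ λ s → let ν = K * (s * K) in (ν ^ ν) * a ^ (s * s) < suc a ^ (s * s)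
-- For `a = 0` one copy suffices, as the left side vanishes.
few-orders K zero     = 1 , subst (_< 1) (sym (*-zeroʳ ((K * (1 * K)) ^ (K * (1 * K))))) z<s
few-orders K (suc a′) = s , (begin-strict
  ν ^ ν * a ^ (s * s)    <⟨ *-monoˡ-< (a ^ (s * s)) {{m^n≢0 a (s * s)}} ν^ν< ⟩
  2 ^ L * a ^ (s * s)    ≤⟨ exp-gap a′ L (s * s) aL≤ ⟩
  suc a ^ (s * s)        ∎)
  where
  open ≤-Reasoning
  open +-*-Solver
  a = suc a′
  -- `C` gathers the factors free of `q` and `s`: since `s = 2 ^ q`, the bound `B` on the logarithm
  -- of `ν` is linear in `q`, so `a * L ≤ s * (C * (1 + q))`, and `q = 3 * C` makes
  -- `C * (1 + q) ≤ s`.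
  C = a * (1 + 2 * K * (K * K) + K * K)
  q = 3 * C
  s = 2 ^ q
  ν = K * (s * K)
  B = K + (q + K)
  L = suc (B * ν)
  ν≤ : ν ≤ 2 ^ B
  ν≤ = begin
    K * (s * K)              ≤⟨ *-mono-≤ (<⇒≤ (n<2^n K)) (*-monoʳ-≤ s (<⇒≤ (n<2^n K))) ⟩
    2 ^ K * (2 ^ q * 2 ^ K)  ≡⟨ cong (2 ^ K *_) (^-distribˡ-+-* 2 q K) ⟨
    2 ^ K * 2 ^ (q + K)      ≡⟨ ^-distribˡ-+-* 2 K (q + K) ⟨
    2 ^ B                    ∎
  ν^ν< : ν ^ ν < 2 ^ L
  ν^ν< = begin-strict
    ν ^ ν        ≤⟨ ^-monoˡ-≤ ν ν≤ ⟩
    (2 ^ B) ^ ν  ≡⟨ ^-*-assoc 2 B ν ⟩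
    2 ^ (B * ν)  <⟨ ^-monoʳ-< 2 (s≤s (s≤s z≤n)) (n<1+n (B * ν)) ⟩
    2 ^ L        ∎
  aL≤ : a * L ≤ s * s
  aL≤ = begin
    a * (1 + B * ν)                        ≤⟨ *-monoʳ-≤ a (+-monoˡ-≤ (B * ν) (m^n>0 2 q)) ⟩
    a * (s + B * ν)
      ≡⟨ solve 4 (λ a K q s → a :* (s :+ (K :+ (q :+ K)) :* (K :* (s :* K)))
           := s :* (a :* (con 1 :+ con 2 :* K :* (K :* K) :+ K :* K :* q))) refl a K q s ⟩
    s * (a * (1 + 2 * K * (K * K) + K * K * q))
      ≤⟨ *-monoʳ-≤ s (≤-trans (m≤m+n _ (a * (K * K) + a * q * (1 + 2 * K * (K * K))))
           (≤-reflexive (solve 3 (λ a K q →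
             a :* (con 1 :+ con 2 :* K :* (K :* K) :+ K :* K :* q)
               :+ (a :* (K :* K) :+ a :* q :* (con 1 :+ con 2 :* K :* (K :* K)))
             := a :* (con 1 :+ con 2 :* K :* (K :* K) :+ K :* K) :* (con 1 :+ q)) refl a K q))) ⟩
    s * (C * (1 + q))                      ≤⟨ *-monoʳ-≤ s (2^3C≥ C) ⟩
    s * s                                  ∎

-- Letters and letter-preserving bijections.

_≟ᴸ_ : (a b : Letter) → Dec (a ≡ b)
X ≟ᴸ X = yes refl
X ≟ᴸ Y = no λ ()
X ≟ᴸ Z = no λ ()
Y ≟ᴸ X = no λ ()
Y ≟ᴸ Y = yes refl
Y ≟ᴸ Z = no λ ()
Z ≟ᴸ X = no λ ()
Z ≟ᴸ Y = no λ ()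
Z ≟ᴸ Z = yes refl

is : Letter → Letter → Bool
is X = isX
is Y = isY
is Z = isZ

is-refl : ∀ c → is c c ≡ true
is-refl X = refl
is-refl Y = refl
is-refl Z = refl

is⇒≡ : ∀ c a → is c a ≡ true → a ≡ c
is⇒≡ X X _ = refl
is⇒≡ Y Y _ = refl
is⇒≡ Z Z _ = refl

swapXY : Letter → Letter
swapXY X = Y
swapXY Y = X
swapXY Z = Z

swapXY-involutive : ∀ c → swapXY (swapXY c) ≡ c
swapXY-involutive X = refl
swapXY-involutive Y = refl
swapXY-involutive Z = refl

isX∘swapXY : ∀ c → isX (swapXY c) ≡ isY c
isX∘swapXY X = refl
isX∘swapXY Y = refl
isX∘swapXY Z = refl

isY∘swapXY : ∀ c → isY (swapXY c) ≡ isX c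
isY∘swapXY X = refl
isY∘swapXY Y = refl
isY∘swapXY Z = refl

isZ∘swapXY : ∀ c → isZ (swapXY c) ≡ isZ c
isZ∘swapXY X = refl
isZ∘swapXY Y = refl
isZ∘swapXY Z = refl

SameCounts : ∀ {n n′} → (Fin n → Letter) → (Fin n′ → Letter) → Set
SameCounts a b = ∀ c → cnt (is c ∘ a) ≡ cnt (is c ∘ b)

Match : ∀ {n n′} → (Fin n → Letter) → (Fin n′ → Letter) → Set
Match {n} {n′} a b = Σ (Permutation n n′) λ π → ∀ p → b (π ⟨$⟩ʳ p) ≡ a p

occurs : ∀ {n} c (a : Fin n → Letter) → 1 ≤ cnt (is c ∘ a) → ∃ λ i → a i ≡ c
occurs {suc n} c a 1≤ with is c (a zero) in eq
... | true  = zero , is⇒≡ c (a zero) eq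
... | false with occurs c (a ∘ suc) 1≤
... | i , e = suc i , e

SameCounts-remove : ∀ {n n′} (a : Fin (suc n) → Letter) (b : Fin (suc n′) → Letter) i → b i ≡ a zero →
  SameCounts a b → SameCounts (a ∘ suc) (b ∘ punchIn i)
SameCounts-remove a b i bi≡a₀ same c = +-cancelˡ-≡ (𝟙 (is c (a zero))) _ _
  (trans (same c) (trans (sum-remove {i = i} (𝟙 ∘ is c ∘ b))
    (cong (λ l → 𝟙 (is c l) + cnt (is c ∘ b ∘ punchIn i)) bi≡a₀)))

extend : ∀ {n n′} (a : Fin (suc n) → Letter) (b : Fin (suc n′) → Letter) i → b i ≡ a zero →
  Match (a ∘ suc) (b ∘ punchIn i) → Match a b
extend a b i bi≡a₀ (π , ok) = insert zero i π , λ
  { zero    → bi≡a₀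
  ; (suc p) → trans (cong b (insert-punchIn zero i π p)) (ok p) }

first-occurs : ∀ {n n′} (a : Fin (suc n) → Letter) (b : Fin n′ → Letter) → SameCounts a b → 1 ≤ cnt (is (a zero) ∘ b)
first-occurs a b same rewrite sym (same (a zero)) | is-refl (a zero) = s≤s z≤n

-- The first letter of `a` occurs in `b` because the counts agree, and removing both occurrences
-- keeps the counts equal.
match : ∀ {n n′} (a : Fin n → Letter) (b : Fin n′ → Letter) → SameCounts a b → Match a b
match {zero} {zero} a b same = Perm.id , λ ()
match {zero} {suc n′} a b same with b zero | same (b zero)
... | c | eq rewrite is-refl c = contradiction eq λ ()
match {suc n} {zero} a b same with occurs (a zero) b (first-occurs a b same)
... | ()
match {suc n} {suc n′} a b same with occurs (a zero) b (first-occurs a b same)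
... | i , bi = extend a b i bi (match (a ∘ suc) (b ∘ punchIn i) (SameCounts-remove a b i bi same))

-- Prescribing the images of 0 and 1 lets a template send the first X and the first Z of the
-- reference word `λ₀` to chosen positions of a sequence.
anchored-match : ∀ {n n′} (a : Fin (suc (suc n)) → Letter) (b : Fin n′ → Letter) → SameCounts a b →
  ∀ i j → i ≢ j → b i ≡ a zero → b j ≡ a (suc zero) →
  Σ (Match a b) λ (π , _) → π ⟨$⟩ʳ zero ≡ i × π ⟨$⟩ʳ suc zero ≡ j
anchored-match {n′ = suc zero} a b same zero zero i≢j = contradiction refl i≢j
anchored-match {n′ = suc (suc _)} a b same i j i≢j bi bj = extend a b i bi rest , refl ,
  trans (insert-punchIn zero i (proj₁ rest) zero) (Fin.punchIn-punchOut i≢j)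
  where
  j′ = punchOut i≢j
  bj′ : b (punchIn i j′) ≡ a (suc zero)
  bj′ = trans (cong b (Fin.punchIn-punchOut i≢j)) bj
  same′ = SameCounts-remove a b i bi same
  rest : Match (a ∘ suc) (b ∘ punchIn i)
  rest = extend (a ∘ suc) (b ∘ punchIn i) j′ bj′
    (match _ _ (SameCounts-remove (a ∘ suc) (b ∘ punchIn i) j′ bj′ same′))

-- Words

count≡cnt : ∀ p σ → count p σ ≡ cnt (p ∘ lookup σ)
count≡cnt p []      = refl
count≡cnt p (a ∷ σ) with p a
... | true  = cong suc (count≡cnt p σ)
... | false = count≡cnt p σ

count-take≡cnt : ∀ p σ s → count p (take s σ) ≡ cnt (λ i → (toℕ i <ᵇ s) ∧ p (lookup σ i))
count-take≡cnt p σ       zero    = sym (cnt-false (length σ))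
count-take≡cnt p []      (suc s) = refl
count-take≡cnt p (a ∷ σ) (suc s) with p a
... | true  = cong suc (count-take≡cnt p σ s)
... | false = count-take≡cnt p σ s

!!-lookup : ∀ (σ : List Letter) i → σ !! toℕ i ≡ just (lookup σ i)
!!-lookup (a ∷ σ) zero    = refl
!!-lookup (a ∷ σ) (suc i) = !!-lookup σ i

lookup-!! : ∀ (σ : List Letter) p {c} → σ !! p ≡ just c → ∃ λ i → toℕ i ≡ p × lookup σ i ≡ c
lookup-!! (a ∷ σ) zero    refl = zero , refl , refl
lookup-!! (a ∷ σ) (suc p) eq with lookup-!! σ p eq
... | i , refl , e = suc i , refl , e

cnt-XZ : ∀ {n} (b : Fin n → Bool) (lab : Fin n → Letter) →
  cnt (λ p → b p ∧ isXZ (lab p)) ≡ cnt (λ p → b p ∧ isX (lab p)) + cnt (λ p → b p ∧ isZ (lab p))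
cnt-XZ b lab = cnt-+ _ (λ p → b p ∧ isX (lab p)) (λ p → b p ∧ isZ (lab p)) (λ p → pointwise (b p) (lab p))
  where
  pointwise : ∀ b c → 𝟙 (b ∧ isXZ c) ≡ 𝟙 (b ∧ isX c) + 𝟙 (b ∧ isZ c)
  pointwise false _ = refl
  pointwise true  X = refl
  pointwise true  Y = refl
  pointwise true  Z = refl

cnt-YZ : ∀ {n} (b : Fin n → Bool) (lab : Fin n → Letter) →
  cnt (λ p → b p ∧ isYZ (lab p)) ≡ cnt (λ p → b p ∧ isY (lab p)) + cnt (λ p → b p ∧ isZ (lab p))
cnt-YZ b lab = cnt-+ _ (λ p → b p ∧ isY (lab p)) (λ p → b p ∧ isZ (lab p)) (λ p → pointwise (b p) (lab p))
  where
  pointwise : ∀ b c → 𝟙 (b ∧ isYZ c) ≡ 𝟙 (b ∧ isY c) + 𝟙 (b ∧ isZ c)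
  pointwise false _ = refl
  pointwise true  X = refl
  pointwise true  Y = refl
  pointwise true  Z = refl

-- Consistency in a decidable form: since both ranks count the preceding Z, only X and Y matter.
Balanced : ∀ {n} → (Fin n → Letter) → (Fin n → Fin n → Bool) → Set
Balanced lab _≺_ = ∀ q → lab q ≡ Z →
  cnt (λ p → (p ≺ q) ∧ isX (lab p)) ≡ cnt (λ p → (p ≺ q) ∧ isY (lab p))

balanced? : ∀ {n} lab (_≺_ : Fin n → Fin n → Bool) → Dec (Balanced lab _≺_)
balanced? lab _≺_ = Fin.all? (λ q → (lab q ≟ᴸ Z) →-dec (_ ≟ _))

Balanced-cong : ∀ {n lab} {R S : Fin n → Fin n → Bool} → (∀ p q → R p q ≡ S p q) → Balanced lab R → Balanced lab S
Balanced-cong {lab = lab} R≡S bal q Zq =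
  trans (cnt-cong (λ p → cong (_∧ isX (lab p)) (sym (R≡S p q))))
  (trans (bal q Zq) (cnt-cong (λ p → cong (_∧ isY (lab p)) (R≡S p q))))

_<ᶠ_ : ∀ {n} → Fin n → Fin n → Bool
i <ᶠ j = toℕ i <ᵇ toℕ j

BalancedSeq : List Letter → Set
BalancedSeq σ = Balanced (lookup σ) _<ᶠ_

balanced⇒consistent : ∀ σ → BalancedSeq σ → ConsistentSeq σ
balanced⇒consistent σ bal p q p<q Zp Zq = cong₂ _,_ (ranks Zp) (ranks Zq)
  where
  ranks : ∀ {p} → σ !! p ≡ just Z → rankXZ σ p ≡ rankYZ σ p
  ranks {p} Zp with lookup-!! σ p Zp
  ... | i , refl , Zi = begin
    count isXZ (take (toℕ i) σ)                 ≡⟨ count-take≡cnt isXZ σ (toℕ i) ⟩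
    cnt (λ j → (j <ᶠ i) ∧ isXZ (lookup σ j))    ≡⟨ cnt-XZ (_<ᶠ i) (lookup σ) ⟩
    cnt (λ j → (j <ᶠ i) ∧ isX (lookup σ j)) + cnt (λ j → (j <ᶠ i) ∧ isZ (lookup σ j))
      ≡⟨ cong (_+ cnt (λ j → (j <ᶠ i) ∧ isZ (lookup σ j))) (bal i Zi) ⟩
    cnt (λ j → (j <ᶠ i) ∧ isY (lookup σ j)) + cnt (λ j → (j <ᶠ i) ∧ isZ (lookup σ j))
      ≡⟨ cnt-YZ (_<ᶠ i) (lookup σ) ⟨
    cnt (λ j → (j <ᶠ i) ∧ isYZ (lookup σ j))    ≡⟨ count-take≡cnt isYZ σ (toℕ i) ⟨
    count isYZ (take (toℕ i) σ)                 ∎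
    where open ≡-Reasoning

words : ℕ → List (List Letter)
words zero    = [] ∷ []
words (suc n) = cartesianProductWith _∷_ (X ∷ Y ∷ Z ∷ []) (words n)

∈-words : ∀ σ → σ List.∈ words (length σ)
∈-words []      = here refl
∈-words (a ∷ σ) = ∈-cartesianProductWith⁺ _∷_ (letter a) (∈-words σ)
  where
  letter : ∀ a → a List.∈ X ∷ Y ∷ Z ∷ []
  letter X = here refl
  letter Y = there (here refl)
  letter Z = there (there (here refl))

Towards : Bool → ℕ → ℕ → Set
Towards true  z x = z < x
Towards false z x = x < z

Separated : Bool → List Letter → Set
Separated b σ = ∃₂ λ sz sx → lookup σ sz ≡ Z × lookup σ sx ≢ Z × Towards b (toℕ sz) (toℕ sx)

-- If no X or Y lay on side `b` of any Z, each Z would be preceded by all of them (`b` true) or by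
-- none (`b` false), in either case by as many X as Y, and σ would be balanced.
separated : ∀ b σ → cnt (isX ∘ lookup σ) ≡ cnt (isY ∘ lookup σ) → ¬ BalancedSeq σ → Separated b σ
separated b σ #X≡#Y unbal = decidable-stable
  (Fin.any? λ sz → Fin.any? λ sx → (lookup σ sz ≟ᴸ Z) ×-dec (¬? (lookup σ sx ≟ᴸ Z) ×-dec towards? b _ _))
  (λ none → unbal (λ s Zs → collapse b s Zs λ i nZ to → none (s , i , Zs , nZ , to)))
  where
  towards? : ∀ b z x → Dec (Towards b z x)
  towards? true  z x = z <? x
  towards? false z x = x <? z

  collapse : ∀ b s → lookup σ s ≡ Z → (∀ i → lookup σ i ≢ Z → ¬ Towards b (toℕ s) (toℕ i)) →
    cnt (λ p → (p <ᶠ s) ∧ isX (lookup σ p)) ≡ cnt (λ p → (p <ᶠ s) ∧ isY (lookup σ p))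
  collapse true s Zs none = trans (cnt-cong (λ i → before i isX refl)) (trans #X≡#Y (sym (cnt-cong (λ i → before i isY refl))))
    where
    before : ∀ i (f : Letter → Bool) → f Z ≡ false → (i <ᶠ s) ∧ f (lookup σ i) ≡ f (lookup σ i)
    before i f fZ with lookup σ i ≟ᴸ Z
    ... | yes Zi rewrite Zi | fZ = ∧-zeroʳ _
    ... | no nZi with <-cmp (toℕ i) (toℕ s)
    ... | tri< i<s _ _ rewrite <ᵇ-true i<s = refl
    ... | tri≈ _ i≡s _ = contradiction (trans (cong (lookup σ) (Fin.toℕ-injective i≡s)) Zs) nZi
    ... | tri> _ _ s<i = contradiction s<i (none i nZi)
  collapse false s Zs none = trans (cnt-cong (λ i → zero-at i isX refl)) (sym (cnt-cong (λ i → zero-at i isY refl)))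
    where
    zero-at : ∀ i (f : Letter → Bool) → f Z ≡ false → (i <ᶠ s) ∧ f (lookup σ i) ≡ false
    zero-at i f fZ with lookup σ i ≟ᴸ Z
    ... | yes Zi rewrite Zi | fZ = ∧-zeroʳ _
    ... | no nZi rewrite <ᵇ-false {toℕ i} (≮⇒≥ (none i nZi)) = refl

-- Inconsistent sequences and their templates.

module Sequences (m : ℕ) where

  -- The reference word gives the letters of the 2r - 2 vertices of every unit, for r = 3 + m.
  -- Vertices 0 and 1 are the X that will be moved and the Z it is compared with. Being unbalanced
  -- itself, the word also shows that there is at least one coordinate.
  λ₀ : List Letter
  λ₀ = X ∷ Z ∷ Y ∷ Z ∷ (replicate m X ++ replicate m Y)

  k : ℕ
  k = length λ₀

  lab : Fin k → Letter
  lab = lookup λ₀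

  count-tail : ∀ p → count p (replicate m X ++ replicate m Y) ≡ m * 𝟙 (p X) + m * 𝟙 (p Y)
  count-tail p = trans (count-++ (replicate m X)) (cong₂ _+_ (count-replicate m X) (count-replicate m Y))
    where
    count-++ : ∀ σ {τ} → count p (σ ++ τ) ≡ count p σ + count p τ
    count-++ []      = refl
    count-++ (a ∷ σ) with p a
    ... | true  = cong suc (count-++ σ)
    ... | false = count-++ σ
    count-replicate : ∀ n c → count p (replicate n c) ≡ n * 𝟙 (p c)
    count-replicate zero    c = refl
    count-replicate (suc n) c with p c in eq
    ... | true  = cong suc (trans (count-replicate n c) (cong (λ b → n * 𝟙 b) eq))
    ... | false = trans (count-replicate n c) (cong (λ b → n * 𝟙 b) eq)

  #X : cnt (isX ∘ lab) ≡ suc m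
  #X = trans (sym (count≡cnt isX λ₀)) (cong suc (trans (count-tail isX)
    (solve 1 (λ m → m :* con 1 :+ m :* con 0 := m) refl m)))
    where open +-*-Solver

  #Y : cnt (isY ∘ lab) ≡ suc m
  #Y = trans (sym (count≡cnt isY λ₀)) (cong suc (trans (count-tail isY)
    (solve 1 (λ m → m :* con 0 :+ m :* con 1 := m) refl m)))
    where open +-*-Solver

  #Z : cnt (isZ ∘ lab) ≡ 2
  #Z = trans (sym (count≡cnt isZ λ₀)) (cong (2 +_) (trans (count-tail isZ)
    (solve 1 (λ m → m :* con 0 :+ m :* con 0 := con 0) refl m)))
    where open +-*-Solver

  #XZ : cnt (isXZ ∘ lab) ≡ 3 + m
  #XZ = trans (cnt-XZ (λ _ → true) lab) (trans (cong₂ _+_ #X #Z) (+-comm (suc m) 2))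

  #YZ : cnt (isYZ ∘ lab) ≡ 3 + m
  #YZ = trans (cnt-YZ (λ _ → true) lab) (trans (cong₂ _+_ #Y #Z) (+-comm (suc m) 2))

  Selected : List Letter → Set
  Selected σ = (cnt (isX ∘ lab) ≡ cnt (isX ∘ lookup σ) × cnt (isY ∘ lab) ≡ cnt (isY ∘ lookup σ)
    × cnt (isZ ∘ lab) ≡ cnt (isZ ∘ lookup σ)) × ¬ BalancedSeq σ

  selected? : ∀ σ → Dec (Selected σ)
  selected? σ = ((_ ≟ _) ×-dec ((_ ≟ _) ×-dec (_ ≟ _))) ×-dec ¬? (balanced? _ _)

  abstract
    seqs : List (List Letter)
    seqs = filter selected? (words k)

  d : ℕ
  d = length seqs

  seq : Fin d → List Letter
  seq = lookup seqs

  abstract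
    seq-selected : ∀ j → Selected (seq j)
    seq-selected j = proj₂ (∈-filter⁻ selected? {xs = words k} (∈-lookup {xs = seqs} j))

    seq-complete : ∀ {σ} → length σ ≡ k → Selected σ → ∃ λ j → seq j ≡ σ
    seq-complete {σ} len sel = index σ∈ , sym (lookup-index σ∈)
      where
      σ∈ : σ List.∈ seqs
      σ∈ = ∈-filter⁺ selected? (subst (λ n → σ List.∈ words n) len (∈-words σ)) sel

  j₀ : Fin d
  j₀ = proj₁ (seq-complete {λ₀} refl ((refl , refl , refl) , unbal))
    where
    unbal : ¬ BalancedSeq λ₀
    -- Position 1 is a Z preceded by one X and no Y, so the equation computes to 1 = 0.
    unbal bal with trans (count-take≡cnt isX λ₀ 1) (trans (bal (suc zero) refl) (sym (count-take≡cnt isY λ₀ 1)))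
    ... | ()

  inconsistent⇒seq : ∀ σ → DescriptiveSeq (3 + m) σ → InconsistentSeq σ → ∃ λ j → seq j ≡ σ
  inconsistent⇒seq σ (len , cX , cY , cZ) incons = seq-complete len′
    ((trans #X (trans (sym cX) (count≡cnt isX σ)) , trans #Y (trans (sym cY) (count≡cnt isY σ))
      , trans #Z (trans (sym cZ) (count≡cnt isZ σ))) , λ bal → incons (balanced⇒consistent σ bal))
    where
    len′ : length σ ≡ k
    len′ = trans len (trans (solve 1 (λ m → con 1 :+ (m :+ (con 3 :+ m :+ con 0)) := con 4 :+ (m :+ m)) refl m)
      (cong (4 +_) (sym (trans (length-++ (replicate m X)) (cong₂ _+_ (length-replicate m) (length-replicate m))))))
      where open +-*-Solver

  -- An arrangement of the vertices of a unit according to σ in which vertex 0 lies on side `b` of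
  -- vertex 1. The letter that σ has on that side of a Z may be a Y whereas vertex 0 is always an X;
  -- hence the exchange of X and Y, which amounts to swapping the twin edges.
  record Template (σ : List Letter) (b : Bool) : Set where
    field
      perm    : Permutation k (length σ)
      letters : (∀ p → lookup σ (perm ⟨$⟩ʳ p) ≡ lab p) ⊎ (∀ p → lookup σ (perm ⟨$⟩ʳ p) ≡ swapXY (lab p))
      towards : Towards b (toℕ (perm ⟨$⟩ʳ suc zero)) (toℕ (perm ⟨$⟩ʳ zero))

    place : Fin k → ℕ
    place p = toℕ (perm ⟨$⟩ʳ p)

  open Template public

  template : ∀ b {σ} → Selected σ → Template σ b
  template b {σ} ((cX , cY , cZ) , unbal) with separated b σ (trans (sym cX) (trans (trans #X (sym #Y)) cY)) unbal
  ... | sz , sx , Zz , nZx , to with lookup σ sx in eq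
  ... | Z = contradiction refl nZx
  ... | X with anchored-match lab (lookup σ) (λ { X → cX ; Y → cY ; Z → cZ })
               sx sz (λ { refl → contradiction (trans (sym eq) Zz) λ () }) eq Zz
  ... | (π , ok) , πx , πz = record { perm = π ; letters = inj₁ ok
    ; towards = subst₂ (λ a b′ → Towards b (toℕ a) (toℕ b′)) (sym πz) (sym πx) to }
  template b {σ} ((cX , cY , cZ) , unbal) | sz , sx , Zz , nZx , to | Y
    with anchored-match lab (swapXY ∘ lookup σ) same sx sz (λ { refl → contradiction (trans (sym eq) Zz) λ () })
           (cong swapXY eq) (cong swapXY Zz)
    where
    same : SameCounts lab (swapXY ∘ lookup σ)
    same X = trans #X (trans (sym #Y) (trans cY (sym (cnt-cong (isX∘swapXY ∘ lookup σ)))))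
    same Y = trans #Y (trans (sym #X) (trans cX (sym (cnt-cong (isY∘swapXY ∘ lookup σ)))))
    same Z = trans cZ (sym (cnt-cong (isZ∘swapXY ∘ lookup σ)))
  ... | (π , ok) , πx , πz = record { perm = π
    ; letters = inj₂ (λ p → trans (sym (swapXY-involutive _)) (cong swapXY (ok p)))
    ; towards = subst₂ (λ a b′ → Towards b (toℕ a) (toℕ b′)) (sym πz) (sym πx) to }

  place-injective : ∀ {σ b} (t : Template σ b) {p q} → place t p ≡ place t q → p ≡ q
  place-injective t {p} {q} e = trans (sym (Perm.inverseˡ (perm t)))
    (trans (cong (perm t ⟨$⟩ˡ_) (Fin.toℕ-injective e)) (Perm.inverseˡ (perm t)))

  -- Counts are invariant under the bijection `perm t`, and exchanging X with Y only swaps the two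
  -- sides of the equation.
  place-balanced : ∀ {σ b} (t : Template σ b) → Balanced lab (λ p q → place t p <ᵇ place t q) → BalancedSeq σ
  place-balanced {σ} t bal s Zs with letters t
  ... | inj₁ ok = trans (sym (moved isX isX λ _ → refl)) (trans (bal q Zq) (moved isY isY λ _ → refl))
    where
    q = perm t ⟨$⟩ˡ s
    Zq : lab q ≡ Z
    Zq = trans (sym (ok q)) (trans (cong (lookup σ) (inverseʳ (perm t))) Zs)
    moved : ∀ f g → (∀ c → f c ≡ g c) → cnt (λ p → (place t p <ᵇ place t q) ∧ f (lab p)) ≡ cnt (λ i → (i <ᶠ s) ∧ g (lookup σ i))
    moved f g f≡g = trans (cnt-cong λ p → cong₂ (λ s c → (place t p <ᵇ toℕ s) ∧ c) (inverseʳ (perm t) {s})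
                            (trans (f≡g (lab p)) (cong g (sym (ok p)))))
                          (cnt-permute (λ i → (i <ᶠ s) ∧ g (lookup σ i)) (perm t))
  ... | inj₂ ok = trans (sym (moved isY isX λ c → sym (isX∘swapXY c))) (trans (sym (bal q Zq)) (moved isX isY λ c → sym (isY∘swapXY c)))
    where
    q = perm t ⟨$⟩ˡ s
    Zq : lab q ≡ Z
    Zq = trans (sym (swapXY-involutive _)) (cong swapXY (trans (sym (ok q)) (trans (cong (lookup σ) (inverseʳ (perm t))) Zs)))
    moved : ∀ f g → (∀ c → f c ≡ g (swapXY c)) →
      cnt (λ p → (place t p <ᵇ place t q) ∧ f (lab p)) ≡ cnt (λ i → (i <ᶠ s) ∧ g (lookup σ i))
    moved f g f≡g = trans (cnt-cong λ p → cong₂ (λ s c → (place t p <ᵇ toℕ s) ∧ c) (inverseʳ (perm t) {s})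
                            (trans (f≡g (lab p)) (cong g (sym (ok p)))))
                          (cnt-permute (λ i → (i <ᶠ s) ∧ g (lookup σ i)) (perm t))

  -- Reversing an order turns "before" into the complement of "before" among the letters other than Z.
  reverse-balanced : (κ : Fin k → ℕ) → (∀ {p q} → κ p ≡ κ q → p ≡ q) →
    Balanced lab (λ p q → κ q <ᵇ κ p) → Balanced lab (λ p q → κ p <ᵇ κ q)
  reverse-balanced κ κ-inj bal q Zq = +-cancelʳ-≡ (cnt (λ p → (κ q <ᵇ κ p) ∧ isX (lab p))) _ _
    (trans (sym (split isX refl)) (trans (trans #X (sym #Y)) (trans (split isY refl) (cong (cnt (λ p → (κ p <ᵇ κ q) ∧ isY (lab p)) +_) (sym (bal q Zq))))))
    where
    split : ∀ f → f Z ≡ false → cnt (f ∘ lab) ≡ cnt (λ p → (κ p <ᵇ κ q) ∧ f (lab p)) + cnt (λ p → (κ q <ᵇ κ p) ∧ f (lab p))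
    split f fZ = cnt-+ _ (λ p → (κ p <ᵇ κ q) ∧ f (lab p)) (λ p → (κ q <ᵇ κ p) ∧ f (lab p)) pointwise
      where
      pointwise : ∀ p → 𝟙 (f (lab p)) ≡ 𝟙 ((κ p <ᵇ κ q) ∧ f (lab p)) + 𝟙 ((κ q <ᵇ κ p) ∧ f (lab p))
      pointwise p with <-cmp (κ p) (κ q)
      ... | tri< p<q _ _ rewrite <ᵇ-true p<q | <ᵇ-false {κ q} (<⇒≤ p<q) = sym (+-identityʳ _)
      ... | tri> _ _ q<p rewrite <ᵇ-true q<p | <ᵇ-false {κ p} (<⇒≤ q<p) = refl
      ... | tri≈ _ p≡q _ rewrite κ-inj p≡q | Zq | fZ | ∧-zeroʳ (κ q <ᵇ κ q) = refl

Towards-not : ∀ b {z x} → Towards b z x → Towards (not b) x z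
Towards-not true  z<x = z<x
Towards-not false x<z = x<z

Towards-<ᵇ : ∀ {x y} → x ≢ y → Towards (x <ᵇ y) x y
Towards-<ᵇ {x} {y} x≢y with <-cmp x y
... | tri< x<y _ _ rewrite <ᵇ-true x<y = x<y
... | tri≈ _ x≡y _ = contradiction x≡y x≢y
... | tri> _ _ y<x rewrite <ᵇ-false {x} (<⇒≤ y<x) = y<x

Towards⇒<ᵇ : ∀ b {x y} → Towards b x y → (x <ᵇ y) ≡ b
Towards⇒<ᵇ true  x<y = <ᵇ-true x<y
Towards⇒<ᵇ false y<x = <ᵇ-false (<⇒≤ y<x)

-- A discrete intermediate value theorem.
flip-point : ∀ n (g : ℕ → Bool) → g n ≡ not (g 0) → ∃ λ i → i < n × g (suc i) ≡ not (g i)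
flip-point zero    g eq = contradiction eq (not-¬ refl)
flip-point (suc n) g eq with g n Bool.≟ g 0
... | yes same = n , ≤-refl , trans eq (cong not (sym same))
... | no differ with flip-point n g (¬-not differ)
... | i , i<n , e = i , m<n⇒m<1+n i<n , e

-- Orders on a grid that respect directions

module Grid {d : ℕ} (j₀ : Fin d) (k : ℕ) (3≤k : 3 ≤ k) where

  Point : Set
  Point = Fin d → ℕ

  Dir : (Fin d → Bool) → Point → Point → Set
  Dir ε u v = ∀ j → Towards (ε j) (u j) (v j)

  -- Levels run from 0 to k + 1. The outermost two are kept for corners, so that every interior
  -- point sees a corner in every direction.
  Bounded Interior : Point → Set
  Bounded u = ∀ j → u j < 2 + k
  Interior u = ∀ j → 1 ≤ u j × u j ≤ k

  interior⇒bounded : ∀ {u} → Interior u → Bounded u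
  interior⇒bounded int j = s≤s (m≤n⇒m≤1+n (proj₂ (int j)))

  corner : (Fin d → Bool) → Point
  corner ε j = if ε j then suc k else 0

  corner-bounded : ∀ ε → Bounded (corner ε)
  corner-bounded ε j with ε j
  ... | true  = ≤-refl
  ... | false = z<s

  corner-dir : ∀ ε {u} → Interior u → Dir ε u (corner ε)
  corner-dir ε int j with ε j
  ... | true  = s≤s (proj₂ (int j))
  ... | false = proj₁ (int j)

  -- `t u v` is to be read as: u precedes v. `rule` is what moving a single X of a balanced unit
  -- will provide.
  module _ (t : Point → Point → Bool)
    (rule : ∀ ε z x x′ → Bounded z → Bounded x → Bounded x′ → Dir ε z x → Dir ε z x′ → t x z ≡ t x′ z)
    (antisym : ∀ ε u v → Bounded u → Bounded v → Dir ε u v → t v u ≡ not (t u v))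
    (transitive : ∀ u v w → t u v ≡ true → t v w ≡ true → t u w ≡ true) where

    centre : Point
    centre _ = 1

    centre-interior : Interior centre
    centre-interior j = ≤-refl , ≤-trans (s≤s z≤n) 3≤k

    F : (Fin d → Bool) → Bool
    F ε = t centre (corner ε)

    -- Seen from `u`, the point `v` may be moved to the corner in direction ε; seen from that
    -- corner, `u` may then be moved to the centre. As `rule` moves the first argument only,
    -- `antisym` brings `v` into that place.
    t≡F : ∀ ε {u v} → Interior u → Bounded v → Dir ε u v → t u v ≡ F ε
    t≡F ε {u} {v} int bnd dir = not-injective (begin
      not (t u v)          ≡⟨ antisym ε u v u-bnd bnd dir ⟨
      t v u                ≡⟨ rule ε u v (corner ε) u-bnd bnd c-bnd dir (corner-dir ε int) ⟩
      t (corner ε) u       ≡⟨ antisym ε u (corner ε) u-bnd c-bnd (corner-dir ε int) ⟩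
      not (t u (corner ε)) ≡⟨ cong not (rule (not ∘ ε) (corner ε) u centre c-bnd u-bnd (interior⇒bounded centre-interior)
                                (λ j → Towards-not (ε j) (corner-dir ε int j))
                                (λ j → Towards-not (ε j) (corner-dir ε centre-interior j))) ⟩
      not (F ε)            ∎)
      where
      open ≡-Reasoning
      u-bnd = interior⇒bounded int
      c-bnd = corner-bounded ε

    -- The sign vectors agree only pointwise, but this already puts the corner of ε in direction ε′
    -- from the centre, where `t≡F` applies.
    F-cong : ∀ {ε ε′} → (∀ j → ε j ≡ ε′ j) → F ε ≡ F ε′
    F-cong {ε} {ε′} eq = t≡F ε′ centre-interior (corner-bounded ε)
      (λ j → subst (λ b → Towards b 1 (corner ε j)) (eq j) (corner-dir ε centre-interior j))

    -- Levels of u, v, w realising the signs ε, ε′ and δ of v − u, w − v and w − u.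
    triple : Bool → Bool → Bool → ℕ × ℕ × ℕ
    triple true  true  _     = 1 , 2 , 3
    triple false false _     = 3 , 2 , 1
    triple true  false true  = 1 , 3 , 2
    triple true  false false = 2 , 3 , 1
    triple false true  true  = 2 , 1 , 3
    triple false true  false = 3 , 1 , 2

    one : 1 ≤ 1 × 1 ≤ k
    one = ≤-refl , ≤-trans (s≤s z≤n) 3≤k

    two : 1 ≤ 2 × 2 ≤ k
    two = s≤s z≤n , ≤-trans (s≤s (s≤s z≤n)) 3≤k

    three : 1 ≤ 3 × 3 ≤ k
    three = s≤s z≤n , 3≤k

    triple-ok : ∀ a b c → (a ≡ b → c ≡ a) → let (x , y , z) = triple a b c in
      ((1 ≤ x × x ≤ k) × (1 ≤ y × y ≤ k) × (1 ≤ z × z ≤ k)) × Towards a x y × Towards b y z × Towards c x z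
    triple-ok true  true  true  _  = (one , two , three) , s≤s (s≤s z≤n) , s≤s (s≤s (s≤s z≤n)) , s≤s (s≤s z≤n)
    triple-ok true  true  false ok = contradiction (ok refl) λ ()
    triple-ok false false false _  = (three , two , one) , s≤s (s≤s (s≤s z≤n)) , s≤s (s≤s z≤n) , s≤s (s≤s z≤n)
    triple-ok false false true  ok = contradiction (ok refl) λ ()
    triple-ok true  false true  _  = (one , three , two) , s≤s (s≤s z≤n) , s≤s (s≤s (s≤s z≤n)) , s≤s (s≤s z≤n)
    triple-ok true  false false _  = (two , three , one) , s≤s (s≤s (s≤s z≤n)) , s≤s (s≤s z≤n) , s≤s (s≤s z≤n)
    triple-ok false true  true  _  = (two , one , three) , s≤s (s≤s z≤n) , s≤s (s≤s z≤n) , s≤s (s≤s (s≤s z≤n))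
    triple-ok false true  false _  = (three , one , two) , s≤s (s≤s z≤n) , s≤s (s≤s z≤n) , s≤s (s≤s (s≤s z≤n))

    -- Transitivity along u, v, w, with steps of signs ε and ε′. In a coordinate where the steps
    -- have opposite signs, their relative lengths can give w - u either sign, so δ is free there.
    mixing : ∀ {ε ε′ δ} → F ε ≡ true → F ε′ ≡ true → (∀ j → ε j ≡ ε′ j → δ j ≡ ε j) → F δ ≡ true
    mixing {ε} {ε′} {δ} Fε Fε′ ok = trans (sym (t≡F δ u-int (interior⇒bounded w-int) (proj₂ ∘ proj₂ ∘ dirs)))
      (transitive u v w (trans (t≡F ε u-int (interior⇒bounded v-int) (proj₁ ∘ dirs)) Fε)
                        (trans (t≡F ε′ v-int (interior⇒bounded w-int) (proj₁ ∘ proj₂ ∘ dirs)) Fε′))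
      where
      levels = λ j → triple (ε j) (ε′ j) (δ j)
      ok′ = λ j → triple-ok (ε j) (ε′ j) (δ j) (ok j)
      dirs = proj₂ ∘ ok′
      u v w : Point
      u = proj₁ ∘ levels
      v = proj₁ ∘ proj₂ ∘ levels
      w = proj₂ ∘ proj₂ ∘ levels
      u-int : Interior u
      u-int = proj₁ ∘ proj₁ ∘ ok′
      v-int : Interior v
      v-int = proj₁ ∘ proj₂ ∘ proj₁ ∘ ok′
      w-int : Interior w
      w-int = proj₂ ∘ proj₂ ∘ proj₁ ∘ ok′

    F-not : ∀ ε → F (not ∘ ε) ≡ not (F ε)
    F-not ε = begin
      F (not ∘ ε)  ≡⟨ t≡F (not ∘ ε) v-int (interior⇒bounded u-int) (λ j → Towards-not (ε j) (dir j)) ⟨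
      t v u        ≡⟨ antisym ε u v (interior⇒bounded u-int) (interior⇒bounded v-int) dir ⟩
      not (t u v)  ≡⟨ cong not (t≡F ε u-int (interior⇒bounded v-int) dir) ⟩
      not (F ε)    ∎
      where
      open ≡-Reasoning
      u v : Point
      u j = if ε j then 1 else 2
      v j = if ε j then 2 else 1
      u-int : Interior u
      u-int j with ε j
      ... | true  = one
      ... | false = two
      v-int : Interior v
      v-int j with ε j
      ... | true  = two
      ... | false = one
      dir : Dir ε u v
      dir j with ε j
      ... | true  = s≤s (s≤s z≤n)
      ... | false = s≤s (s≤s z≤n)

    jump : ∀ {i} (i<d : i < d) {j′ : Fin d} → toℕ j′ ≡ i → j′ ≡ fromℕ< i<d
    jump i<d e = Fin.toℕ-injective (trans e (sym (Fin.toℕ-fromℕ< i<d)))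

    no-jump : ∀ {i a} → a ≢ i → (a <ᵇ i) ≡ (a <ᵇ suc i)
    no-jump {i} {a} a≢i with <-cmp a i
    ... | tri< a<i _ _ = trans (<ᵇ-true a<i) (sym (<ᵇ-true (m<n⇒m<1+n a<i)))
    ... | tri≈ _ e _   = contradiction e a≢i
    ... | tri> _ _ i<a = trans (<ᵇ-false (<⇒≤ i<a)) (sym (<ᵇ-false i<a))

    -- Flip the signs one by one from all negative to all positive. If F changes when sign j is flipped,
    -- then of the two sign vectors at that moment and their negatives, two that agree only in j have
    -- F true, and mixing them produces every sign vector with that j-th entry.
    decisive : ∃₂ λ j b → ∀ δ → δ j ≡ b → F δ ≡ true
    decisive with flip-point d (F ∘ h) (trans (F-cong {h d} {not ∘ h 0} (λ j → <ᵇ-true (Fin.toℕ<n j))) (F-not (h 0)))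
      where
      h : ℕ → Fin d → Bool
      h i j = toℕ j <ᵇ i
    ... | i , i<d , change with F (λ j → toℕ j <ᵇ i) in Fε
    -- The vectors `h i` and the negation of `h (suc i)` agree only at `j`, where both are negative;
    -- the other case negates `h i` instead.
    ... | true = j , false , λ δ δj → mixing Fε (trans (F-not (λ j → toℕ j <ᵇ suc i)) (cong not change)) (agree δ δj)
      where
      j = fromℕ< i<d
      agree : ∀ δ → δ j ≡ false → ∀ j′ → (toℕ j′ <ᵇ i) ≡ not (toℕ j′ <ᵇ suc i) → δ j′ ≡ (toℕ j′ <ᵇ i)
      agree δ δj j′ eq with toℕ j′ ≟ i
      ... | yes e = trans (trans (cong δ (jump i<d e)) δj) (sym (<ᵇ-false (≤-reflexive (sym e))))
      ... | no ne = contradiction eq (not-¬ (no-jump ne))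
    ... | false = j , true , λ δ δj → mixing (trans (F-not (λ j → toℕ j <ᵇ i)) (cong not Fε)) change (agree δ δj)
      where
      j = fromℕ< i<d
      agree : ∀ δ → δ j ≡ true → ∀ j′ → not (toℕ j′ <ᵇ i) ≡ (toℕ j′ <ᵇ suc i) → δ j′ ≡ not (toℕ j′ <ᵇ i)
      agree δ δj j′ eq with toℕ j′ ≟ i
      ... | yes e = trans (trans (cong δ (jump i<d e)) δj) (cong not (sym (<ᵇ-false (≤-reflexive (sym e)))))
      ... | no ne = contradiction (sym eq) (not-¬ (sym (no-jump ne)))

    order-by-coordinate : ∃₂ λ j b → ∀ u v → Interior u → Interior v → (∀ i → u i ≢ v i) →
      Towards b (u j) (v j) → t u v ≡ true
    order-by-coordinate with decisive
    ... | j , b , dec = j , b , λ u v u-int v-int u≢v to →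
      trans (t≡F (λ i → u i <ᵇ v i) u-int (interior⇒bounded v-int) (λ i → Towards-<ᵇ (u≢v i))) (dec _ (Towards⇒<ᵇ b to))

-- An increasing sequence of heights whose entry sz is zl and whose entry sx is y, where b tells whether
-- sz < sx. Entries on the side of sx away from sz go beyond all other heights, so only entry sx depends on y.
slot : ℕ → Bool → (zl y sz sx s : ℕ) → ℕ
slot top true zl y sz sx s with <-cmp s sx
... | tri< _ _ _ = zl + s ∸ sz
... | tri≈ _ _ _ = y
... | tri> _ _ _ = top + s
slot top false zl y sz sx s with <-cmp s sx
... | tri< _ _ _ = s
... | tri≈ _ _ _ = y
... | tri> _ _ _ = zl + s ∸ sz

-- A gap of `k` between `zl` and `y` leaves room for the entries placed relative to `zl`; the
-- entries beyond `y` have the range above `top` or the one below `k` to themselves.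
Fits : ℕ → ℕ → Bool → (zl y : ℕ) → Set
Fits k top true  zl y = zl + k ≤ y × y ≤ top
Fits k top false zl y = k ≤ y × y + k ≤ zl

-- `Fits` separates the ranges of the entries before, at and after `sx`, and `k ≤ zl` keeps the
-- truncated subtraction exact.
slot-mono : ∀ {k top} b {zl y sz sx s s′} → k ≤ zl → Fits k top b zl y → sz < k → s < s′ → s′ < k →
  slot top b zl y sz sx s < slot top b zl y sz sx s′
slot-mono {k} {top} true {zl} {y} {sz} {sx} {s} {s′} k≤zl (zl+k≤y , y≤top) sz<k s<s′ s′<k with <-cmp s sx | <-cmp s′ sx
... | tri< _ _ _ | tri< _ _ _ = ∸-monoˡ-< (+-monoʳ-< zl s<s′) (≤-trans (<⇒≤ sz<k) (≤-trans k≤zl (m≤m+n zl s)))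
... | tri< _ _ _ | tri≈ _ _ _ = <-≤-trans (≤-<-trans (m∸n≤m (zl + s) sz) (+-monoʳ-< zl (<-trans s<s′ s′<k))) zl+k≤y
... | tri< _ _ _ | tri> _ _ _ = <-≤-trans (≤-<-trans (m∸n≤m (zl + s) sz) (+-monoʳ-< zl (<-trans s<s′ s′<k)))
  (≤-trans zl+k≤y (≤-trans y≤top (m≤m+n top s′)))
... | tri≈ _ refl _ | tri< a _ _ = contradiction s<s′ (<-asym a)
... | tri≈ _ refl _ | tri≈ _ refl _ = contradiction s<s′ (<-irrefl refl)
... | tri≈ _ _ _ | tri> _ _ _ = ≤-<-trans y≤top (m<m+n top (≤-<-trans z≤n s<s′))
... | tri> _ _ a | tri< b _ _ = contradiction (<-trans s<s′ (<-trans b a)) (<-irrefl refl)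
... | tri> _ _ a | tri≈ _ refl _ = contradiction s<s′ (<-asym a)
... | tri> _ _ _ | tri> _ _ _ = +-monoʳ-< top s<s′
slot-mono {k} {top} false {zl} {y} {sz} {sx} {s} {s′} k≤zl (k≤y , y+k≤zl) sz<k s<s′ s′<k with <-cmp s sx | <-cmp s′ sx
... | tri< _ _ _ | tri< _ _ _ = s<s′
... | tri< _ _ _ | tri≈ _ _ _ = <-≤-trans (<-trans s<s′ s′<k) k≤y
... | tri< _ _ _ | tri> _ _ _ = <-≤-trans (<-trans s<s′ s′<k) (≤-trans k≤y
  (m+n≤o⇒m≤o∸n y (≤-trans (+-monoʳ-≤ y (<⇒≤ sz<k)) (≤-trans y+k≤zl (m≤m+n zl s′)))))
... | tri≈ _ refl _ | tri< a _ _ = contradiction s<s′ (<-asym a)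
... | tri≈ _ refl _ | tri≈ _ refl _ = contradiction s<s′ (<-irrefl refl)
... | tri≈ _ _ _ | tri> _ _ _ = m+n≤o⇒m≤o∸n (suc y) (≤-trans (+-monoʳ-< y sz<k) (≤-trans y+k≤zl (m≤m+n zl s′)))
... | tri> _ _ a | tri< b _ _ = contradiction (<-trans s<s′ (<-trans b a)) (<-irrefl refl)
... | tri> _ _ a | tri≈ _ refl _ = contradiction s<s′ (<-asym a)
... | tri> _ _ _ | tri> _ _ _ = ∸-monoˡ-< (+-monoʳ-< zl s<s′) (≤-trans (<⇒≤ sz<k) (≤-trans k≤zl (m≤m+n zl s)))

slot-sx : ∀ {top} b {zl y sz} sx → slot top b zl y sz sx sx ≡ y
slot-sx true sx with <-cmp sx sx
... | tri< a _ _ = contradiction a (<-irrefl refl)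
... | tri≈ _ _ _ = refl
... | tri> _ _ a = contradiction a (<-irrefl refl)
slot-sx false sx with <-cmp sx sx
... | tri< a _ _ = contradiction a (<-irrefl refl)
... | tri≈ _ _ _ = refl
... | tri> _ _ a = contradiction a (<-irrefl refl)

slot-sz : ∀ {top} b {zl y sz sx} → Towards b sz sx → slot top b zl y sz sx sz ≡ zl
slot-sz true {zl} {sz = sz} {sx} to with <-cmp sz sx
... | tri< _ _ _ = m+n∸n≡m zl sz
... | tri≈ n _ _ = contradiction to n
... | tri> n _ _ = contradiction to n
slot-sz false {zl} {sz = sz} {sx} to with <-cmp sz sx
... | tri< _ _ n = contradiction to n
... | tri≈ _ _ n = contradiction to n
... | tri> _ _ _ = m+n∸n≡m zl sz

slot-off : ∀ {top} b {zl y y′ sz sx s} → s ≢ sx → slot top b zl y sz sx s ≡ slot top b zl y′ sz sx s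
slot-off true {sx = sx} {s} s≢sx with <-cmp s sx
... | tri< _ _ _ = refl
... | tri≈ _ e _ = contradiction e s≢sx
... | tri> _ _ _ = refl
slot-off false {sx = sx} {s} s≢sx with <-cmp s sx
... | tri< _ _ _ = refl
... | tri≈ _ e _ = contradiction e s≢sx
... | tri> _ _ _ = refl

slot-bound : ∀ {k top} b {zl y sz sx s} → zl ≤ top → y ≤ top → s < k → slot top b zl y sz sx s < top + k
slot-bound {k} {top} true {zl} {sz = sz} {sx} {s} zl≤ y≤ s<k with <-cmp s sx
... | tri< _ _ _ = ≤-<-trans (m∸n≤m (zl + s) sz) (+-mono-≤-< zl≤ s<k)
... | tri≈ _ _ _ = ≤-<-trans y≤ (m<m+n top (≤-<-trans z≤n s<k))
... | tri> _ _ _ = +-monoʳ-< top s<k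
slot-bound {k} {top} false {zl} {sz = sz} {sx} {s} zl≤ y≤ s<k with <-cmp s sx
... | tri< _ _ _ = <-≤-trans s<k (m≤n+m k top)
... | tri≈ _ _ _ = ≤-<-trans y≤ (m<m+n top (≤-<-trans z≤n s<k))
... | tri> _ _ _ = ≤-<-trans (m∸n≤m (zl + s) sz) (+-mono-≤-< zl≤ s<k)

-- The units of the grid.

bit : Fin 2 → Bool
bit zero    = false
bit (suc _) = true

unbit : Bool → Fin 2
unbit false = zero
unbit true  = suc zero

bit-unbit : ∀ b → bit (unbit b) ≡ b
bit-unbit false = refl
bit-unbit true  = refl

module Units (m : ℕ) where

  open Sequences m

  3≤k : 3 ≤ k
  3≤k = s≤s (s≤s (s≤s z≤n))

  open Grid j₀ k 3≤k

  -- Consecutive levels are `k` apart, so the other vertices of a unit fit between them. The offset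
  -- 2 keeps a value clamped to `k` below a level at least `k`, above the entries that `slot` puts
  -- at the bottom.
  height : ℕ → ℕ
  height i = k * (2 + i)

  c top N : ℕ
  c   = 2 + k
  top = height c
  N   = top + k

  clamp : Bool → (zl xl : ℕ) → ℕ
  clamp true  zl xl = xl ⊔ (zl + k)
  clamp false zl xl = xl ⊓ (zl ∸ k)

  height-mono-≤ : ∀ {a b} → a ≤ b → height a ≤ height b
  height-mono-≤ a≤b = *-monoʳ-≤ k (+-monoʳ-≤ 2 a≤b)

  height-mono-< : ∀ {a b} → a < b → height a < height b
  height-mono-< a<b = *-monoʳ-< k (+-monoʳ-< 2 a<b)

  height-suc : ∀ a → height (suc a) ≡ height a + k
  height-suc a = trans (*-suc k (2 + a)) (+-comm k (height a))

  2k≤height : ∀ a → k + k ≤ height a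
  2k≤height a = ≤-trans (≤-reflexive (trans (cong (k +_) (sym (*-identityʳ k))) (sym (*-suc k 1)))) (*-monoʳ-≤ k (m≤m+n 2 a))

  k≤height : ∀ a → k ≤ height a
  k≤height a = ≤-trans (m≤m+n k k) (2k≤height a)

  height+k≤ : ∀ {a b} → a < b → height a + k ≤ height b
  height+k≤ {a} a<b = ≤-trans (≤-reflexive (sym (height-suc a))) (height-mono-≤ a<b)

  clamp-towards : ∀ b {z x} → Towards b z x → clamp b (height z) (height x) ≡ height x
  clamp-towards true  z<x = m≥n⇒m⊔n≡m (height+k≤ z<x)
  clamp-towards false x<z = m≤n⇒m⊓n≡m (m+n≤o⇒m≤o∸n _ (height+k≤ x<z))

  clamp-fits : ∀ b {z x} → z < c → x < c → Fits k top b (height z) (clamp b (height z) (height x))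
  clamp-fits true  {z} {x} z<c x<c = m≤n⊔m (height x) _ , ⊔-lub (height-mono-≤ (<⇒≤ x<c)) (height+k≤ z<c)
  clamp-fits false {z} {x} z<c x<c = ⊓-glb (k≤height x) (m+n≤o⇒m≤o∸n k (2k≤height z)) ,
    ≤-trans (+-monoˡ-≤ k (m⊓n≤n (height x) _)) (≤-reflexive (m∸n+n≡m (k≤height z)))

  clamp≤top : ∀ b {z x} → z < c → x < c → clamp b (height z) (height x) ≤ top
  clamp≤top true  z<c x<c = proj₂ (clamp-fits true z<c x<c)
  clamp≤top false {x = x} z<c x<c = ≤-trans (m⊓n≤m (height x) _) (height-mono-≤ (<⇒≤ x<c))

  abstract
    tmpl : ∀ j b → Template (seq j) b
    tmpl j b = template b (seq-selected j)

  place<k : ∀ {σ b} (t : Template σ b) p → place t p < k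
  place<k t p = subst (place t p <_) (sym (Perm.↔⇒≡ (perm t))) (Fin.toℕ<n _)

  -- Vertices 0 and 1 carry an X and a Z. Only vertex 0 depends on x; it is the grid point x when x lies in
  -- direction ε from z, and is clamped into that direction otherwise so that every code yields a legal unit.
  probe : Point → (Fin d → Bool) → Point → Fin k → Point
  probe z ε x p j = slot top (ε j) (height (z j)) (clamp (ε j) (height (z j)) (height (x j)))
    (place t (suc zero)) (place t zero) (place t p)
    where t = tmpl j (ε j)

  -- Interior points that each coordinate `j` arranges as `seq j` prescribes. An order given by
  -- coordinate `j` or its reverse cannot balance this unit.
  ladder : Fin k → Point
  ladder p j = suc (place (tmpl j true) p)

  #probes : ℕ
  #probes = c ^ d * (2 ^ d * c ^ d)

  decode : Fin #probes → Point × (Fin d → Bool) × Point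
  decode i = split (remQuot (2 ^ d * c ^ d) i)
    module Decode where
    read : Fin (c ^ d) → Fin (2 ^ d) × Fin (c ^ d) → Point × (Fin d → Bool) × Point
    read z (ε , x) = toℕ ∘ finToFun z , bit ∘ finToFun ε , toℕ ∘ finToFun x
    split : Fin (c ^ d) × Fin (2 ^ d * c ^ d) → Point × (Fin d → Bool) × Point
    split (z , εx) = read z (remQuot (c ^ d) εx)

  decode-combine : ∀ z ε x → decode (combine z (combine ε x)) ≡ (toℕ ∘ finToFun z , bit ∘ finToFun ε , toℕ ∘ finToFun x)
  decode-combine z ε x = trans (cong (Decode.split zero′) (Fin.remQuot-combine z (combine ε x)))
                               (cong (Decode.read zero′ z) (Fin.remQuot-combine ε x))
    where zero′ = combine z (combine ε x)

  unit : Fin (suc #probes) → Fin k → Point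
  unit zero    p j = height (ladder p j)
  unit (suc i) = let z , ε , x = decode i in probe z ε x

  -- This is why sorting by coordinate `j` will admit `seq j`.
  unit-template : ∀ i j → ∃ λ b → Σ (Template (seq j) b) λ t → ∀ p q → place t p < place t q → unit i p j < unit i q j
  unit-template zero    j = true , tmpl j true , λ p q p<q → height-mono-< (s≤s p<q)
  unit-template (suc i) j = _ , t , λ p q p<q →
    slot-mono (ε j) (k≤height _) (clamp-fits (ε j) (Fin.toℕ<n _) (Fin.toℕ<n _)) (place<k t (suc zero)) p<q (place<k t q)
    where
    ε = proj₁ (proj₂ (decode i))
    t = tmpl j (ε j)

  unit-bound : ∀ i p j → unit i p j < N
  unit-bound zero    p j = ≤-<-trans (height-mono-≤ (≤-trans (place<k (tmpl j true) p) (m≤n+m k 2))) (m<m+n top z<s)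
  unit-bound (suc i) p j = slot-bound (ε j) (height-mono-≤ (<⇒≤ (Fin.toℕ<n _))) (clamp≤top (ε j) (Fin.toℕ<n _) (Fin.toℕ<n _))
    (place<k (tmpl j (ε j)) p)
    where ε = proj₁ (proj₂ (decode i))

  probe-cong : ∀ {z z′ x x′ : Point} {ε ε′ : Fin d → Bool} → (∀ j → z j ≡ z′ j) → (∀ j → ε j ≡ ε′ j) → (∀ j → x j ≡ x′ j) →
    ∀ p j → probe z ε x p j ≡ probe z′ ε′ x′ p j
  probe-cong z≗ ε≗ x≗ p j rewrite z≗ j | ε≗ j | x≗ j = refl

  unit-probe : ∀ {z x} ε → Bounded z → Bounded x → ∃ λ i → ∀ p j → unit i p j ≡ probe z ε x p j
  unit-probe {z} {x} ε z-bnd x-bnd = suc (combine zᶜ (combine εᶜ xᶜ)) , eq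
    where
    zᶜ = funToFin (λ j → fromℕ< (z-bnd j))
    xᶜ = funToFin (λ j → fromℕ< (x-bnd j))
    εᶜ = funToFin (λ j → unbit (ε j))
    roundtrip : ∀ {z} (z-bnd : Bounded z) j → toℕ (finToFun (funToFin (λ j → fromℕ< (z-bnd j))) j) ≡ z j
    roundtrip z-bnd j = trans (cong toℕ (Fin.finToFun-funToFin (λ j → fromℕ< (z-bnd j)) j)) (Fin.toℕ-fromℕ< (z-bnd j))
    eq : ∀ p j → unit (suc (combine zᶜ (combine εᶜ xᶜ))) p j ≡ probe z ε x p j
    eq p j = trans (cong (λ (z , ε , x) → probe z ε x p j) (decode-combine zᶜ εᶜ xᶜ))
      (probe-cong (roundtrip z-bnd) (λ j → trans (cong bit (Fin.finToFun-funToFin (unbit ∘ ε) j)) (bit-unbit (ε j)))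
        (roundtrip x-bnd) p j)

  probe-z : ∀ (z : Point) ε (x : Point) j → probe z ε x (suc zero) j ≡ height (z j)
  probe-z z ε x j = slot-sz (ε j) (towards (tmpl j (ε j)))

  probe-x : ∀ {z ε} {x : Point} → Dir ε z x → ∀ j → probe z ε x zero j ≡ height (x j)
  probe-x {ε = ε} dir j = trans (slot-sx (ε j) (place (tmpl j (ε j)) zero)) (clamp-towards (ε j) (dir j))

  probe-rest : ∀ (z : Point) ε (x x′ : Point) p j → probe z ε x (suc p) j ≡ probe z ε x′ (suc p) j
  probe-rest z ε x x′ p j = slot-off (ε j) (λ e → contradiction (place-injective (tmpl j (ε j)) e) λ ())

  -- Vertex 0 carries an X, so moving it alone in a balanced unit cannot change its side of a Z.
  pivot : ∀ (e e′ : Fin k → Bool) → (∀ p → e (suc p) ≡ e′ (suc p)) →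
    cnt (λ p → e p ∧ isX (lab p)) ≡ cnt (λ p → e p ∧ isY (lab p)) →
    cnt (λ p → e′ p ∧ isX (lab p)) ≡ cnt (λ p → e′ p ∧ isY (lab p)) → e zero ≡ e′ zero
  pivot e e′ rest bal bal′ = trans (sym (∧-identityʳ (e zero))) (trans (𝟙-injective (+-cancelʳ-≡ tailX _ _ both)) (∧-identityʳ (e′ zero)))
    where
    tailX = cnt (λ p → e′ (suc p) ∧ isX (lab (suc p)))
    𝟙-injective : ∀ {a b} → 𝟙 a ≡ 𝟙 b → a ≡ b
    𝟙-injective {false} {false} _ = refl
    𝟙-injective {true}  {true}  _ = refl
    both : 𝟙 (e zero ∧ true) + tailX ≡ 𝟙 (e′ zero ∧ true) + tailX
    both = begin
      𝟙 (e zero ∧ true) + tailX           ≡⟨ cong (𝟙 (e zero ∧ true) +_) (cnt-cong (λ p → cong (_∧ isX (lab (suc p))) (rest p))) ⟨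
      cnt (λ p → e p ∧ isX (lab p))       ≡⟨ bal ⟩
      cnt (λ p → e p ∧ isY (lab p))       ≡⟨ cnt-cong sameY ⟩
      cnt (λ p → e′ p ∧ isY (lab p))      ≡⟨ bal′ ⟨
      cnt (λ p → e′ p ∧ isX (lab p))      ∎
      where
      open ≡-Reasoning
      sameY : ∀ p → e p ∧ isY (lab p) ≡ e′ p ∧ isY (lab p)
      sameY zero    = trans (∧-zeroʳ (e zero)) (sym (∧-zeroʳ (e′ zero)))
      sameY (suc p) = cong (_∧ isY (lab (suc p))) (rest p)

  module _ (ρ : Point → ℕ) (ρ-cong : ∀ {u v} → (∀ j → u j ≡ v j) → ρ u ≡ ρ v)
    (ρ-inj : ∀ {u v} → (∀ j → u j < N) → (∀ j → v j < N) → ρ u ≡ ρ v → ∀ j → u j ≡ v j) where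

    -- Here ρ ranks the points in an arbitrary order. Balance of the probes yields `rule` for the
    -- points with coordinates on the chosen heights, so one coordinate or its reverse gives the
    -- order on interior points that differ in every coordinate; balance of the ladder then
    -- contradicts the choice of `seq j`.
    some-unit-unbalanced : ¬ (∀ i → Balanced lab (λ p q → ρ (unit i p) <ᵇ ρ (unit i q)))
    some-unit-unbalanced bal = by-coordinate order-of-t
      where
      lift : Point → Point
      lift u j = height (u j)

      t : Point → Point → Bool
      t u v = ρ (lift u) <ᵇ ρ (lift v)

      lift-bound : ∀ {u} → Bounded u → ∀ j → lift u j < N
      lift-bound bnd j = ≤-<-trans (height-mono-≤ (<⇒≤ (bnd j))) (m<m+n top z<s)

      probe-balanced : ∀ z ε x → Bounded z → Bounded x → Balanced lab (λ p q → ρ (probe z ε x p) <ᵇ ρ (probe z ε x q))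
      probe-balanced z ε x z-bnd x-bnd with unit-probe ε z-bnd x-bnd
      ... | i , eq = Balanced-cong (λ p q → cong₂ _<ᵇ_ (ρ-cong (eq p)) (ρ-cong (eq q))) (bal i)

      t-probe : ∀ {z ε x} → Dir ε z x → (ρ (probe z ε x zero) <ᵇ ρ (probe z ε x (suc zero))) ≡ t x z
      t-probe {z} {ε} {x} dir = cong₂ _<ᵇ_ (ρ-cong (probe-x dir)) (ρ-cong (probe-z z ε x))

      rule : ∀ ε z x x′ → Bounded z → Bounded x → Bounded x′ → Dir ε z x → Dir ε z x′ → t x z ≡ t x′ z
      rule ε z x x′ z-bnd x-bnd x′-bnd dir dir′ = trans (sym (t-probe dir)) (trans
        (pivot (λ p → ρ (probe z ε x p) <ᵇ ρ (probe z ε x (suc zero))) (λ p → ρ (probe z ε x′ p) <ᵇ ρ (probe z ε x′ (suc zero)))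
          (λ p → cong₂ _<ᵇ_ (ρ-cong (probe-rest z ε x x′ p)) (ρ-cong (probe-rest z ε x x′ zero)))
          (probe-balanced z ε x z-bnd x-bnd (suc zero) refl) (probe-balanced z ε x′ z-bnd x′-bnd (suc zero) refl))
        (t-probe dir′))

      asym : ∀ {u v} → t u v ≡ true → t v u ≡ false
      asym {u} {v} uv = <ᵇ-false (<⇒≤ (<ᵇ-true⁻ {ρ (lift u)} uv))

      height-injective : ∀ {a b} → height a ≡ height b → a ≡ b
      height-injective {a} {b} e with <-cmp a b
      ... | tri< a<b _ _ = contradiction e (<⇒≢ (height-mono-< a<b))
      ... | tri≈ _ a≡b _ = a≡b
      ... | tri> _ _ b<a = contradiction (sym e) (<⇒≢ (height-mono-< b<a))

      Towards-irrefl : ∀ b {x y} → Towards b x y → x ≢ y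
      Towards-irrefl true  x<y refl = <-irrefl refl x<y
      Towards-irrefl false y<x refl = <-irrefl refl y<x

      antisym : ∀ ε u v → Bounded u → Bounded v → Dir ε u v → t v u ≡ not (t u v)
      antisym ε u v u-bnd v-bnd dir with <-cmp (ρ (lift u)) (ρ (lift v))
      ... | tri< a _ _ = trans (<ᵇ-false (<⇒≤ a)) (cong not (sym (<ᵇ-true a)))
      -- Equal ranks would force equal points, but these differ in every coordinate; `j₀` supplies
      -- one.
      ... | tri≈ _ e _ = contradiction (height-injective (ρ-inj (lift-bound u-bnd) (lift-bound v-bnd) e j₀)) (Towards-irrefl (ε j₀) (dir j₀))
      ... | tri> _ _ a = trans (<ᵇ-true a) (cong not (sym (<ᵇ-false (<⇒≤ a))))

      transitive : ∀ u v w → t u v ≡ true → t v w ≡ true → t u w ≡ true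
      transitive u v w uv vw = <ᵇ-true (<-trans (<ᵇ-true⁻ {ρ (lift u)} {ρ (lift v)} uv) (<ᵇ-true⁻ {ρ (lift v)} {ρ (lift w)} vw))

      order-of-t = order-by-coordinate t rule antisym transitive

      ladder-interior : ∀ p → Interior (ladder p)
      ladder-interior p j = s≤s z≤n , place<k (tmpl j true) p

      by-coordinate : ¬ (∃₂ λ j b → ∀ u v → Interior u → Interior v → (∀ i → u i ≢ v i) → Towards b (u j) (v j) → t u v ≡ true)
      by-coordinate (j , b , ordered) = proj₂ (seq-selected j) (place-balanced (tmpl j true) (oriented b ordered-ladder))
        where
        pl = place (tmpl j true)

        ordered-ladder : ∀ p q → p ≢ q → Towards b (suc (pl p)) (suc (pl q)) → t (ladder p) (ladder q) ≡ true
        ordered-ladder p q p≢q = ordered (ladder p) (ladder q) (ladder-interior p) (ladder-interior q)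
          (λ i e → p≢q (place-injective (tmpl i true) (suc-injective e)))

        oriented : ∀ b → (∀ p q → p ≢ q → Towards b (suc (pl p)) (suc (pl q)) → t (ladder p) (ladder q) ≡ true) →
          Balanced lab (λ p q → pl p <ᵇ pl q)
        oriented true ord = Balanced-cong compare (bal zero)
          where
          compare : ∀ p q → t (ladder p) (ladder q) ≡ (pl p <ᵇ pl q)
          compare p q with <-cmp (pl p) (pl q)
          ... | tri< a _ _ = trans (ord p q (λ { refl → <-irrefl refl a }) (s≤s a)) (sym (<ᵇ-true a))
          ... | tri≈ _ e _ rewrite place-injective (tmpl j true) {p} {q} e = trans (<ᵇ-false {ρ (lift (ladder q))} ≤-refl) (sym (<ᵇ-false {pl q} ≤-refl))
          ... | tri> _ _ a = trans (asym {ladder q} {ladder p} (ord q p (λ { refl → <-irrefl refl a }) (s≤s a))) (sym (<ᵇ-false (<⇒≤ a)))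
        -- The ladder is ranked in reverse of coordinate `j`, and reversal preserves balance.
        oriented false ord = reverse-balanced pl (place-injective (tmpl j true)) (Balanced-cong compare (bal zero))
          where
          compare : ∀ p q → t (ladder p) (ladder q) ≡ (pl q <ᵇ pl p)
          compare p q with <-cmp (pl q) (pl p)
          ... | tri< a _ _ = trans (ord p q (λ { refl → <-irrefl refl a }) (s≤s a)) (sym (<ᵇ-true a))
          ... | tri≈ _ e _ rewrite place-injective (tmpl j true) {q} {p} e = trans (<ᵇ-false {ρ (lift (ladder p))} ≤-refl) (sym (<ᵇ-false {pl p} ≤-refl))
          ... | tri> _ _ a = trans (asym {ladder q} {ladder p} (ord q p (λ { refl → <-irrefl refl a }) (s≤s a))) (sym (<ᵇ-false (<⇒≤ a)))

-- The grid with its units as a finite system.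

record BaseSystem (m : ℕ) : Set where
  open Sequences m
  field
    K M N : ℕ
    base  : Fin (suc M) → Fin k → Fin K
    coord : Fin d → Fin K → Fin N
    base-injective : ∀ i {p q} → base i p ≡ base i q → p ≡ q
    base-template  : ∀ i j → ∃ λ b → Σ (Template (seq j) b) λ t →
      ∀ p q → place t p < place t q → toℕ (coord j (base i p)) < toℕ (coord j (base i q))
    base-unbalanced : ∀ (ρ : Fin K → ℕ) → Injective _≡_ _≡_ ρ →
      ¬ (∀ i → Balanced lab (λ p q → ρ (base i p) <ᵇ ρ (base i q)))

funToFin-cong : ∀ {a b} {f g : Fin a → Fin b} → (∀ i → f i ≡ g i) → funToFin f ≡ funToFin g
funToFin-cong {zero}  f≗g = refl
funToFin-cong {suc a} f≗g = cong₂ combine (f≗g zero) (funToFin-cong (λ i → f≗g (suc i)))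

baseSystem : ∀ m → BaseSystem m
baseSystem m = record
  { K = N ^ d ; M = #probes ; N = N
  ; base = λ i p → code (unit i p)
  ; coord = λ j v → finToFun v j
  ; base-injective = base-inj
  ; base-template = λ i j → let b , t , mono = unit-template i j in b , t , λ p q p<q →
      subst₂ _<_ (sym (coord-code i p j)) (sym (coord-code i q j)) (mono p q p<q)
  ; base-unbalanced = λ ρ ρ-inj → some-unit-unbalanced (ρ ∘ code) (λ u≗v → cong ρ (code-cong u≗v))
      (λ u<N v<N e → code-injective u<N v<N (ρ-inj e))
  }
  where
  open Sequences m
  open Units m
  open Grid j₀ k 3≤k using (Point)

  clip : ℕ → Fin N
  clip i with i <? N
  ... | yes i<N = fromℕ< i<N
  -- A default outside the grid; all coordinates of units lie below `N`.
  ... | no _    = zero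

  toℕ-clip : ∀ {i} → i < N → toℕ (clip i) ≡ i
  toℕ-clip {i} i<N with i <? N
  ... | yes i<N′ = Fin.toℕ-fromℕ< i<N′
  ... | no i≮N   = contradiction i<N i≮N

  code : Point → Fin (N ^ d)
  code u = funToFin (λ j → clip (u j))

  code-cong : ∀ {u v : Point} → (∀ j → u j ≡ v j) → code u ≡ code v
  code-cong u≗v = funToFin-cong (λ j → cong clip (u≗v j))

  decode-code : ∀ {u : Point} → (∀ j → u j < N) → ∀ j → toℕ (finToFun (code u) j) ≡ u j
  decode-code {u} u<N j = trans (cong toℕ (Fin.finToFun-funToFin (λ j → clip (u j)) j)) (toℕ-clip (u<N j))

  code-injective : ∀ {u v : Point} → (∀ j → u j < N) → (∀ j → v j < N) → code u ≡ code v → ∀ j → u j ≡ v j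
  code-injective u<N v<N e j = trans (sym (decode-code u<N j))
    (trans (cong (λ x → toℕ (finToFun x j)) e) (decode-code v<N j))

  coord-code : ∀ i p j → toℕ (finToFun (code (unit i p)) j) ≡ unit i p j
  coord-code i p j = decode-code (unit-bound i p) j

  -- Coordinate `j₀` alone tells the vertices of a unit apart.
  base-inj : ∀ i {p q} → code (unit i p) ≡ code (unit i q) → p ≡ q
  base-inj i {p} {q} e with unit-template i j₀ | code-injective (unit-bound i p) (unit-bound i q) e j₀
  ... | b , t , mono | same with <-cmp (place t p) (place t q)
  ... | tri< a _ _ = contradiction same (<⇒≢ (mono p q a))
  ... | tri≈ _ a _ = place-injective t a
  ... | tri> _ _ a = contradiction (sym same) (<⇒≢ (mono q p a))

-- Almost disjoint copies along lines.

module Lines (K s : ℕ) where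

  -- φ encodes slope and intercept, and the number of a grid point serves as its abscissa; copy φ is
  -- the graph of this line in a K by sK array.
  on-line : Fin (s * s) → Fin K → ℕ
  on-line φ v = let a , b = remQuot {s} s φ in toℕ a * toℕ v + toℕ b

  on-line-bound : ∀ φ v → on-line φ v < s * K
  on-line-bound φ v = let a , b = remQuot {s} s φ in begin-strict
    toℕ a * toℕ v + toℕ b  <⟨ +-mono-≤-< (*-monoˡ-≤ (toℕ v) (<⇒≤ (Fin.toℕ<n a))) (Fin.toℕ<n b) ⟩
    s * toℕ v + s          ≡⟨ +-comm (s * toℕ v) s ⟩
    s + s * toℕ v          ≡⟨ *-suc s (toℕ v) ⟨
    s * suc (toℕ v)        ≤⟨ *-monoʳ-≤ s (Fin.toℕ<n v) ⟩
    s * K                  ∎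
    where open ≤-Reasoning

  abstract
    copy : Fin (s * s) → Fin K → Fin (K * (s * K))
    copy φ v = combine v (fromℕ< (on-line-bound φ v))

    source : Fin (K * (s * K)) → Fin K
    source w = proj₁ (remQuot {K} (s * K) w)

    source-copy : ∀ φ v → source (copy φ v) ≡ v
    source-copy φ v = cong proj₁ (Fin.remQuot-combine {K} v (fromℕ< (on-line-bound φ v)))

    copy-injective : ∀ φ φ′ {v v′} → copy φ v ≡ copy φ′ v′ → v ≡ v′
    copy-injective φ φ′ {v} {v′} e = Fin.combine-injectiveˡ v _ v′ _ e

    copy-on-line : ∀ φ φ′ {v v′} → copy φ v ≡ copy φ′ v′ → on-line φ v ≡ on-line φ′ v′
    copy-on-line φ φ′ {v} {v′} e = trans (sym (Fin.toℕ-fromℕ< (on-line-bound φ v)))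
      (trans (cong toℕ (Fin.combine-injectiveʳ v _ v′ _ e)) (Fin.toℕ-fromℕ< (on-line-bound φ′ v′)))

  -- Subtracting the two equations leaves equal multiples of the positive difference w - v, which
  -- can be cancelled.
  slope : ∀ {a b a′ b′ v w} → v < w → a * v + b ≡ a′ * v + b′ → a * w + b ≡ a′ * w + b′ → a ≡ a′ × b ≡ b′
  slope {a} {b} {a′} {b′} {v} {w} v<w atv atw with e , refl ← m≤n⇒∃[o]m+o≡n v<w = a≡a′ ,
    +-cancelˡ-≡ (a * v) b b′ (trans atv (cong (λ x → x * v + b′) (sym a≡a′)))
    where
    open +-*-Solver
    step : ∀ a b → a * (suc v + e) + b ≡ a * v + b + a * suc e
    step a b = solve 4 (λ a b v e → a :* (con 1 :+ v :+ e) :+ b := a :* v :+ b :+ a :* (con 1 :+ e)) refl a b v e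
    a≡a′ : a ≡ a′
    a≡a′ = *-cancelʳ-≡ a a′ (suc e) (+-cancelˡ-≡ (a * v + b) _ _ (trans (sym (step a b))
      (trans atw (trans (step a′ b′) (cong (_+ a′ * suc e) (sym atv))))))

  two-points : ∀ φ φ′ {v w} → v ≢ w → on-line φ v ≡ on-line φ′ v → on-line φ w ≡ on-line φ′ w → φ ≡ φ′
  two-points φ φ′ {v} {w} v≢w atv atw = begin
    φ                                ≡⟨ Fin.combine-remQuot {s} s φ ⟨
    combine a b                      ≡⟨ cong₂ combine (Fin.toℕ-injective (proj₁ same)) (Fin.toℕ-injective (proj₂ same)) ⟩
    combine a′ b′                    ≡⟨ Fin.combine-remQuot {s} s φ′ ⟩
    φ′                               ∎
    where
    open ≡-Reasoning
    a = proj₁ (remQuot {s} s φ)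
    b = proj₂ (remQuot {s} s φ)
    a′ = proj₁ (remQuot {s} s φ′)
    b′ = proj₂ (remQuot {s} s φ′)
    same : toℕ a ≡ toℕ a′ × toℕ b ≡ toℕ b′
    same with <-cmp (toℕ v) (toℕ w)
    ... | tri< v<w _ _ = slope v<w atv atw
    ... | tri≈ _ v≡w _ = contradiction (Fin.toℕ-injective v≡w) v≢w
    ... | tri> _ _ w<v = slope w<v atw atv

abstract
  enough-lines : ∀ K a → ∃ λ s → let ν = K * (s * K) in (ν ^ ν) * a ^ (s * s) < suc a ^ (s * s)
  enough-lines = few-orders

⌊⌋-true : ∀ {P : Set} {P? : Dec P} → P → ⌊ P? ⌋ ≡ true
⌊⌋-true {P? = yes _} _ = refl
⌊⌋-true {P? = no ¬p} p = contradiction p ¬p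

⌊⌋-true⁻ : ∀ {P : Set} {P? : Dec P} → ⌊ P? ⌋ ≡ true → P
⌊⌋-true⁻ {P? = yes p} _ = p

∈-tabulate⁺ : ∀ {ν} (f : Fin ν → Bool) {w} → f w ≡ true → w ∈ Vec.tabulate f
∈-tabulate⁺ f {w} fw = Vec.lookup⇒[]= w (Vec.tabulate f) (trans (Vec.lookup∘tabulate f w) fw)

∈-tabulate⁻ : ∀ {ν} (f : Fin ν → Bool) {w} → w ∈ Vec.tabulate f → f w ≡ true
∈-tabulate⁻ f {w} w∈ = trans (sym (Vec.lookup∘tabulate f w)) (Vec.[]=⇒lookup w∈)

at-most-one : ∀ {ν} (S : Subset ν) → (∀ {v w} → v ∈ S → w ∈ S → v ≡ w) → ∣ S ∣ ≤ 1
at-most-one {ν} S one with nonempty? S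
... | yes (v , v∈) = subst (∣ S ∣ ≤_) (∣⁅x⁆∣≡1 v) (p⊆q⇒∣p∣≤∣q∣ (λ w∈ → subst (_∈ ⁅ v ⁆) (one v∈ w∈) (x∈⁅x⁆ v)))
... | no empty = subst (λ T → ∣ T ∣ ≤ 1) (sym (Empty-unique empty)) (subst (_≤ 1) (sym (∣⊥∣≡0 ν)) z≤n)

-- The blow-up and the choice of one unit per copy.

module BlowUp (m : ℕ) (B : BaseSystem m) where

  open Sequences m
  open BaseSystem B

  s Q ν : ℕ
  s = proj₁ (enough-lines K M)
  Q = s * s
  ν = K * (s * K)

  open Lines K s

  abstract
    -- Orders are coded among all ν^ν self-maps of the vertex set, a family whose size is immediate;
    -- its maps that are not injective are merely further candidates to refute.
    value : Fin (ν ^ ν) → Fin ν → ℕ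
    value o w = toℕ (finToFun o w)

    value-surjective : ∀ (π : Order ν) → ∃ λ o → ∀ w → value o w ≡ rank π w
    value-surjective π = funToFin (π ⟨$⟩ʳ_) , λ w → cong toℕ (Fin.finToFun-funToFin (π ⟨$⟩ʳ_) w)

  precedes : (Fin ν → ℕ) → Fin Q → Fin (suc M) → Fin k → Fin k → Bool
  precedes ρ φ i p q = ρ (copy φ (base i p)) <ᵇ ρ (copy φ (base i q))

  unbalanced? : ∀ ρ φ → Dec (∃ λ i → ¬ Balanced lab (precedes ρ φ i))
  unbalanced? ρ φ = Fin.any? (λ i → ¬? (balanced? lab (precedes ρ φ i)))

  pick : {P : Fin (suc M) → Set} → Dec (∃ P) → Fin (suc M)
  pick (yes (i , _)) = i
  -- In `culprit`, this default can occur only for maps that are not injective.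
  pick (no _)        = zero

  pick-satisfies : {P : Fin (suc M) → Set} (P? : Dec (∃ P)) → ¬ ¬ ∃ P → P (pick P?)
  pick-satisfies (yes (_ , p)) _     = p
  pick-satisfies (no none)     ¬none = contradiction none ¬none

  culprit : Fin (ν ^ ν) → Fin Q → Fin (suc M)
  culprit o φ = pick (unbalanced? (value o) φ)

  -- An injective ranking of the blow-up restricts along `copy φ` to one of the grid, where some
  -- unit is unbalanced.
  culprit-unbalanced : ∀ o φ → Injective _≡_ _≡_ (value o) → ¬ Balanced lab (precedes (value o) φ (culprit o φ))
  culprit-unbalanced o φ inj = pick-satisfies (unbalanced? (value o) φ) (λ none →
    base-unbalanced (value o ∘ copy φ) (λ e → copy-injective φ φ (inj e))
      (λ i → decidable-stable (balanced? lab (precedes (value o) φ i)) (λ unbal → none (i , unbal))))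

  abstract
    assignment : ∃ λ (A : Fin Q → Fin (suc M)) → ∀ o → true ≡ true → ∃ λ φ → culprit o φ ≡ A φ
    assignment = greedy M Q culprit (λ _ → true)
      (subst (λ x → x * M ^ Q < suc M ^ Q) (sym (cnt-true (ν ^ ν))) (proj₂ (enough-lines K M)))

  chosen : Fin Q → Fin (suc M)
  chosen = proj₁ assignment

  vertex : Fin Q → Fin k → Fin ν
  vertex φ p = copy φ (base (chosen φ) p)

  unbalanced-copy : ∀ o → Injective _≡_ _≡_ (value o) → ∃ λ φ → ¬ Balanced lab (precedes (value o) φ (chosen φ))
  unbalanced-copy o inj = let φ , hit = proj₂ assignment o refl in
    φ , subst (λ i → ¬ Balanced lab (precedes (value o) φ i)) hit (culprit-unbalanced o φ inj)

  rank-injective : ∀ (π : Order ν) {v w} → rank π v ≡ rank π w → v ≡ w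
  rank-injective π e = trans (sym (Perm.inverseˡ π)) (trans (cong (π Perm.⟨$⟩ˡ_) (Fin.toℕ-injective e)) (Perm.inverseˡ π))

  every-order-fails : ∀ (π : Order ν) → ∃ λ φ → ¬ Balanced lab (precedes (rank π) φ (chosen φ))
  every-order-fails π =
    let o , value≡rank = value-surjective π
        φ , unbal = unbalanced-copy o (λ {v} {w} e → rank-injective π (trans (sym (value≡rank v)) (trans e (value≡rank w))))
    in φ , λ bal → unbal (Balanced-cong {R = precedes (rank π) φ (chosen φ)} {S = precedes (value o) φ (chosen φ)}
         (λ p q → sym (cong₂ _<ᵇ_ (value≡rank (vertex φ p)) (value≡rank (vertex φ q)))) bal)

  vertex-injective : ∀ φ → Injective _≡_ _≡_ (vertex φ)
  vertex-injective φ e = base-injective (chosen φ) (copy-injective φ φ e)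

  -- Two shared vertices over different grid points would be two common points of distinct lines.
  vertex-shared : ∀ {φ φ′} → φ ≢ φ′ → ∀ {p p′ q q′} → vertex φ p ≡ vertex φ′ p′ → vertex φ q ≡ vertex φ′ q′ →
    vertex φ p ≡ vertex φ q
  vertex-shared {φ} {φ′} φ≢φ′ {p} {p′} {q} {q′} ep eq with base (chosen φ) p Fin.≟ base (chosen φ) q
  ... | yes same = cong (copy φ) same
  ... | no differ = contradiction (two-points φ φ′ differ (line ep) (line eq)) φ≢φ′
    where
    line : ∀ {v v′} → copy φ v ≡ copy φ′ v′ → on-line φ v ≡ on-line φ′ v
    line {v} {v′} e = trans (copy-on-line φ φ′ e) (cong (on-line φ′) (sym (copy-injective φ φ′ e)))

  -- Twin edges and quasi-linearity.

  carries : Fin 2 → Letter → Bool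
  carries zero    = isXZ
  carries (suc _) = isYZ

  Label : Set
  Label = Fin Q × Fin 2

  abstract
    edgeOf : Label → Subset ν
    edgeOf (φ , x) = Vec.tabulate (λ w → ⌊ Fin.any? (λ p → (carries x (lab p) Bool.≟ true) ×-dec (vertex φ p Fin.≟ w)) ⌋)

    ∈-edge⁻ : ∀ {φ x w} → w ∈ edgeOf (φ , x) → ∃ λ p → carries x (lab p) ≡ true × vertex φ p ≡ w
    ∈-edge⁻ w∈ = ⌊⌋-true⁻ (∈-tabulate⁻ _ w∈)

    ∈-edge⁺ : ∀ {φ x p} → carries x (lab p) ≡ true → vertex φ p ∈ edgeOf (φ , x)
    ∈-edge⁺ {p = p} c = ∈-tabulate⁺ _ (⌊⌋-true (p , c , refl))

  vertex∈edge⁻ : ∀ {φ x p} → vertex φ p ∈ edgeOf (φ , x) → carries x (lab p) ≡ true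
  vertex∈edge⁻ {φ} {x} {p} w∈ with ∈-edge⁻ w∈
  ... | p′ , c , e = subst (λ p → carries x (lab p) ≡ true) (vertex-injective φ e) c

  ∣edge∣ : ∀ i → ∣ edgeOf i ∣ ≡ 3 + m
  ∣edge∣ (φ , x) = trans (card-image (vertex φ) (vertex-injective φ) (carries x ∘ lab) _ ∈-edge⁻ (λ _ → ∈-edge⁺)) (size x)
    where
    size : ∀ x → cnt (carries x ∘ lab) ≡ 3 + m
    size zero    = #XZ
    size (suc _) = #YZ

  XZ∧YZ⇒Z : ∀ c → isXZ c ≡ true → isYZ c ≡ true → c ≡ Z
  XZ∧YZ⇒Z Z _ _ = refl

  Z⇒carried : ∀ x {c} → c ≡ Z → carries x c ≡ true
  Z⇒carried zero    refl = refl
  Z⇒carried (suc _) refl = refl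

  ∣twins∣ : ∀ φ → ∣ edgeOf (φ , zero) ∩ edgeOf (φ , suc zero) ∣ ≡ 2
  ∣twins∣ φ = trans (card-image (vertex φ) (vertex-injective φ) (isZ ∘ lab) _ shared both) #Z
    where
    both : ∀ p → isZ (lab p) ≡ true → vertex φ p ∈ edgeOf (φ , zero) ∩ edgeOf (φ , suc zero)
    both p z = x∈p∩q⁺ (∈-edge⁺ (Z⇒carried zero (is⇒≡ Z _ z)) , ∈-edge⁺ (Z⇒carried (suc zero) (is⇒≡ Z _ z)))
    shared : ∀ {w} → w ∈ edgeOf (φ , zero) ∩ edgeOf (φ , suc zero) → ∃ λ p → isZ (lab p) ≡ true × vertex φ p ≡ w
    shared w∈ with x∈p∩q⁻ (edgeOf (φ , zero)) _ w∈
    ... | w∈e , w∈f with ∈-edge⁻ w∈e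
    ... | p , c , refl = p , cong isZ (XZ∧YZ⇒Z (lab p) c (vertex∈edge⁻ w∈f)) , refl

  ∣strangers∣ : ∀ {φ φ′} x x′ → φ ≢ φ′ → ∣ edgeOf (φ , x) ∩ edgeOf (φ′ , x′) ∣ ≤ 1
  ∣strangers∣ {φ} {φ′} x x′ φ≢φ′ = at-most-one _ same
    where
    same : ∀ {v w} → v ∈ edgeOf (φ , x) ∩ edgeOf (φ′ , x′) → w ∈ edgeOf (φ , x) ∩ edgeOf (φ′ , x′) → v ≡ w
    same v∈ w∈ with x∈p∩q⁻ (edgeOf (φ , x)) _ v∈ | x∈p∩q⁻ (edgeOf (φ , x)) _ w∈
    ... | v∈e , v∈f | w∈e , w∈f with ∈-edge⁻ v∈e | ∈-edge⁻ v∈f | ∈-edge⁻ w∈e | ∈-edge⁻ w∈f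
    ... | p , _ , refl | p′ , _ , ep | q , _ , refl | q′ , _ , eq = vertex-shared φ≢φ′ {p} {p′} {q} {q′} (sym ep) (sym eq)

  data Relation : Label → Label → Set where
    same     : ∀ {i} → Relation i i
    twins₀₁  : ∀ φ → Relation (φ , zero) (φ , suc zero)
    twins₁₀  : ∀ φ → Relation (φ , suc zero) (φ , zero)
    stranger : ∀ {φ φ′ x x′} → φ ≢ φ′ → Relation (φ , x) (φ′ , x′)

  relation : ∀ i j → Relation i j
  relation (φ , x) (φ′ , x′) with φ Fin.≟ φ′
  ... | no φ≢φ′ = stranger φ≢φ′
  relation (φ , zero)     (φ , zero)     | yes refl = same
  relation (φ , zero)     (φ , suc zero) | yes refl = twins₀₁ φ
  relation (φ , suc zero) (φ , zero)     | yes refl = twins₁₀ φ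
  relation (φ , suc zero) (φ , suc zero) | yes refl = same

  -- Equal edges meet in 3 + m vertices, whereas edges with different labels meet in at most two.
  edgeOf-injective : ∀ i j → edgeOf i ≡ edgeOf j → i ≡ j
  edgeOf-injective i j e with relation i j
  ... | same = refl
  ... | twins₀₁ φ = contradiction (trans (sym (∣edge∣ i)) (trans (cong ∣_∣ (sym (∩-idem (edgeOf i))))
    (trans (cong (λ f → ∣ edgeOf i ∩ f ∣) e) (∣twins∣ φ)))) λ ()
  ... | twins₁₀ φ = contradiction (trans (sym (∣edge∣ i)) (trans (cong ∣_∣ (sym (∩-idem (edgeOf i))))
    (trans (cong (λ f → ∣ f ∩ edgeOf i ∣) e) (∣twins∣ φ)))) λ ()
  ... | stranger {φ} {φ′} {x} {x′} φ≢φ′ = contradiction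
    (subst (_≤ 1) (trans (cong (λ f → ∣ edgeOf i ∩ f ∣) (sym e)) (trans (cong ∣_∣ (∩-idem (edgeOf i))) (∣edge∣ i))) (∣strangers∣ x x′ φ≢φ′))
    λ { (s≤s ()) }

  label : Fin (Q * 2) → Label
  label = remQuot 2

  label-injective : ∀ {i j} → label i ≡ label j → i ≡ j
  label-injective {i} {j} e = trans (sym (Fin.combine-remQuot {Q} 2 i))
    (trans (cong (λ (φ , x) → combine φ x) e) (Fin.combine-remQuot {Q} 2 j))

  label-combine : ∀ φ x → label (combine φ x) ≡ (φ , x)
  label-combine = Fin.remQuot-combine

  F : Hypergraph (3 + m)
  F = record
    { n = ν ; m = Q * 2 ; edge = λ i → edgeOf (label i) ; uniform = λ i → ∣edge∣ (label i)
    ; distinct = λ i j e → label-injective (edgeOf-injective (label i) (label j) e) }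

  F-quasiLinear : QuasiLinear F
  F-quasiLinear e = combine φ x′ , e≢f , ∩≡2 , others
    where
    φ = proj₁ (label e)
    other : Fin 2 → Fin 2
    other zero    = suc zero
    other (suc _) = zero
    x′ = other (proj₂ (label e))
    f≡ : label (combine φ x′) ≡ (φ , x′)
    f≡ = label-combine φ x′
    other≢ : ∀ x → x ≢ other x
    other≢ zero    ()
    other≢ (suc _) ()
    e≢f : e ≢ combine φ x′
    e≢f eq = other≢ (proj₂ (label e)) (cong proj₂ (trans (cong label eq) f≡))
    ∣∩∣ : ∀ x → ∣ edgeOf (φ , x) ∩ edgeOf (φ , other x) ∣ ≡ 2
    ∣∩∣ zero       = ∣twins∣ φ
    ∣∩∣ (suc zero) = trans (cong ∣_∣ (∩-comm (edgeOf (φ , suc zero)) (edgeOf (φ , zero)))) (∣twins∣ φ)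
    ∩≡2 : ∣ edgeOf (label e) ∩ edgeOf (label (combine φ x′)) ∣ ≡ 2
    ∩≡2 = trans (cong (λ l → ∣ edgeOf (label e) ∩ edgeOf l ∣) f≡) (∣∩∣ (proj₂ (label e)))
    both : ∀ x y → y ≡ x ⊎ y ≡ other x
    both zero       zero       = inj₁ refl
    both zero       (suc zero) = inj₂ refl
    both (suc zero) zero       = inj₂ refl
    both (suc zero) (suc zero) = inj₁ refl
    others : ∀ f′ → f′ ≢ e → f′ ≢ combine φ x′ → ∣ edgeOf (label e) ∩ edgeOf (label f′) ∣ ≤ 1
    others f′ f′≢e f′≢f = ∣strangers∣ (proj₂ (label e)) (proj₂ (label f′)) differ
      where
      differ : φ ≢ proj₁ (label f′)
      differ eq with both (proj₂ (label e)) (proj₂ (label f′))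
      ... | inj₁ x≡ = f′≢e (label-injective (cong₂ _,_ (sym eq) x≡))
      ... | inj₂ x≡ = f′≢f (label-injective (trans (cong₂ _,_ (sym eq) x≡) (sym f≡)))

  -- Inconsistency of the blow-up.

  below⁻ : ∀ (π : Order ν) {u w} → w ∈ below π u → rank π w < rank π u
  below⁻ π w∈ = ⌊⌋-true⁻ (∈-tabulate⁻ _ w∈)

  below⁺ : ∀ (π : Order ν) {u w} → rank π w < rank π u → w ∈ below π u
  below⁺ π w<u = ∈-tabulate⁺ _ (⌊⌋-true w<u)

  ∧-true⁻ : ∀ {a b : Bool} → a ∧ b ≡ true → a ≡ true × b ≡ true
  ∧-true⁻ {true} {true} _ = refl , refl

  pos≡cnt : ∀ (π : Order ν) φ (S : Subset ν) (f : Fin k → Bool) →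
    (∀ {w} → w ∈ S → ∃ λ p → f p ≡ true × vertex φ p ≡ w) → (∀ p → f p ≡ true → vertex φ p ∈ S) →
    ∀ q → pos π S (vertex φ q) ≡ cnt (λ p → (rank π (vertex φ p) <ᵇ rank π (vertex φ q)) ∧ f p)
  pos≡cnt π φ S f S⊆ ⊆S q = card-image (vertex φ) (vertex-injective φ) _ _ to from
    where
    to : ∀ {w} → w ∈ S ∩ below π (vertex φ q) → ∃ λ p →
      (rank π (vertex φ p) <ᵇ rank π (vertex φ q)) ∧ f p ≡ true × vertex φ p ≡ w
    to w∈ with x∈p∩q⁻ S _ w∈
    ... | w∈S , w∈b with S⊆ w∈S
    ... | p , fp , refl = p , cong₂ _∧_ (<ᵇ-true (below⁻ π w∈b)) fp , refl
    from : ∀ p → (rank π (vertex φ p) <ᵇ rank π (vertex φ q)) ∧ f p ≡ true → vertex φ p ∈ S ∩ below π (vertex φ q)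
    from p fp with ∧-true⁻ fp
    ... | lt , fp = x∈p∩q⁺ (⊆S p fp , below⁺ π (<ᵇ-true⁻ lt))

  -- Equal roles give each Z equal positions in the two twin edges. Cancelling the preceding Z's
  -- leaves equal counts of X and Y, so the unit in every copy would be balanced.
  F-inconsistent : Inconsistent F
  F-inconsistent (π , consistent) with every-order-fails π
  ... | φ , unbal = unbal balanced
    where
    κ : Fin k → ℕ
    κ p = rank π (vertex φ p)

    e f : Subset ν
    e = edgeOf (φ , zero)
    f = edgeOf (φ , suc zero)

    role-e≡role-f : ∀ {q q′} → q ≢ q′ → lab q ≡ Z → lab q′ ≡ Z → role π e (vertex φ q) (vertex φ q′) ≡ role π f (vertex φ q) (vertex φ q′)
    role-e≡role-f {q} {q′} q≢q′ Zq Zq′ = subst₂ (λ i j → role π (edgeOf i) (vertex φ q) (vertex φ q′) ≡ role π (edgeOf j) (vertex φ q) (vertex φ q′))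
      (label-combine φ zero) (label-combine φ (suc zero))
      (consistent i j i≢j ∣∩∣ (vertex φ q) (vertex φ q′) (q≢q′ ∘ vertex-injective φ) (shared Zq) (shared Zq′))
      where
      i = combine φ zero
      j = combine φ (suc zero)
      i≢j : i ≢ j
      i≢j eq = contradiction (Fin.combine-injectiveʳ φ zero φ (suc zero) eq) λ ()
      ∣∩∣ : ∣ edgeOf (label i) ∩ edgeOf (label j) ∣ ≡ 2
      ∣∩∣ = trans (cong₂ (λ a b → ∣ edgeOf a ∩ edgeOf b ∣) (label-combine φ zero) (label-combine φ (suc zero))) (∣twins∣ φ)
      shared : ∀ {q} → lab q ≡ Z → vertex φ q ∈ edgeOf (label i) ∩ edgeOf (label j)
      shared {q} Zq = subst₂ (λ a b → vertex φ q ∈ edgeOf a ∩ edgeOf b) (sym (label-combine φ zero)) (sym (label-combine φ (suc zero)))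
        (x∈p∩q⁺ (∈-edge⁺ (Z⇒carried zero Zq) , ∈-edge⁺ (Z⇒carried (suc zero) Zq)))

    pos-mono : ∀ x {q q′} → κ q ≤ κ q′ → pos π (edgeOf (φ , x)) (vertex φ q) ≤ pos π (edgeOf (φ , x)) (vertex φ q′)
    pos-mono x {q} {q′} q≤q′ rewrite pos≡cnt π φ (edgeOf (φ , x)) (carries x ∘ lab) ∈-edge⁻ (λ _ → ∈-edge⁺) q
                            | pos≡cnt π φ (edgeOf (φ , x)) (carries x ∘ lab) ∈-edge⁻ (λ _ → ∈-edge⁺) q′ =
      cnt-mono (λ p lt → let a , b = ∧-true⁻ {b = carries x (lab p)} lt in cong₂ _∧_ (<ᵇ-true (<-≤-trans (<ᵇ-true⁻ {κ p} {κ q} a) q≤q′)) b)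

    -- A role is a minimum and a maximum of positions. Positions in either edge grow with the rank,
    -- so the same vertex attains the minimum in both.
    compare : ∀ q q′ → q ≢ q′ → lab q ≡ Z → lab q′ ≡ Z → pos π e (vertex φ q) ≡ pos π f (vertex φ q)
    compare q q′ q≢q′ Zq Zq′ with ≤-total (κ q) (κ q′) | role-e≡role-f q≢q′ Zq Zq′
    ... | inj₁ q≤q′ | roles = trans (sym (m≤n⇒m⊓n≡m (pos-mono zero q≤q′)))
      (trans (cong proj₁ roles) (m≤n⇒m⊓n≡m (pos-mono (suc zero) q≤q′)))
    ... | inj₂ q′≤q | roles = trans (sym (m≥n⇒m⊔n≡m (pos-mono zero q′≤q)))
      (trans (cong proj₂ roles) (m≥n⇒m⊔n≡m (pos-mono (suc zero) q′≤q)))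

    pos-e≡pos-f : ∀ q → lab q ≡ Z → pos π e (vertex φ q) ≡ pos π f (vertex φ q)
    pos-e≡pos-f q Zq with q Fin.≟ suc zero
    -- The letters Z of `λ₀` stand at 1 and 3, so 3 partners 1 and 1 partners any other Z.
    ... | yes refl = compare q (suc (suc (suc zero))) (λ ()) refl refl
    ... | no q≢1   = compare q (suc zero) q≢1 Zq refl

    balanced : Balanced lab (λ p q → κ p <ᵇ κ q)
    balanced q Zq = +-cancelʳ-≡ (cnt (λ p → (κ p <ᵇ κ q) ∧ isZ (lab p))) _ _ (begin
      _  ≡⟨ cnt-XZ (λ p → κ p <ᵇ κ q) lab ⟨
      cnt (λ p → (κ p <ᵇ κ q) ∧ isXZ (lab p))  ≡⟨ pos≡cnt π φ e (isXZ ∘ lab) ∈-edge⁻ (λ _ → ∈-edge⁺) q ⟨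
      pos π e (vertex φ q)                     ≡⟨ pos-e≡pos-f q Zq ⟩
      pos π f (vertex φ q)                     ≡⟨ pos≡cnt π φ f (isYZ ∘ lab) ∈-edge⁻ (λ _ → ∈-edge⁺) q ⟩
      cnt (λ p → (κ p <ᵇ κ q) ∧ isYZ (lab p))  ≡⟨ cnt-YZ (λ p → κ p <ᵇ κ q) lab ⟩
      _  ∎)
      where open ≡-Reasoning

  -- Admission of every inconsistent sequence.

  module _ (j : Fin d) where

    -- Coordinate `j` decides first, and ties are broken by the vertex itself, which makes the key
    -- injective. No ties occur within a unit.
    key : Fin ν → ℕ
    key w = toℕ (combine (coord j (source w)) w)

    key-injective : Injective _≡_ _≡_ key
    key-injective {v} {w} e = Fin.combine-injectiveʳ (coord j (source v)) v (coord j (source w)) w (Fin.toℕ-injective e)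

    abstract
      sorted : Σ (Order ν) λ π → ∀ v w → key v < key w → rank π v < rank π w
      sorted = sort key key-injective

    π : Order ν
    π = proj₁ sorted

    key-mono : ∀ {φ p q} → toℕ (coord j (base (chosen φ) p)) < toℕ (coord j (base (chosen φ) q)) → key (vertex φ p) < key (vertex φ q)
    key-mono {φ} {p} {q} p<q = Fin.combine-monoˡ-< (vertex φ p) (vertex φ q)
      (subst₂ (λ a b → toℕ (coord j a) < toℕ (coord j b)) (sym (source-copy φ _)) (sym (source-copy φ _)) p<q)

    module _ (φ : Fin Q) where

      t = proj₁ (proj₂ (base-template (chosen φ) j))

      rank-mono : ∀ {p q} → place t p < place t q → rank π (vertex φ p) < rank π (vertex φ q)
      rank-mono {p} {q} p<q = proj₂ sorted (vertex φ p) (vertex φ q)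
        (key-mono (proj₂ (proj₂ (base-template (chosen φ) j)) p q p<q))

      rank-<ᵇ : ∀ p q → (rank π (vertex φ p) <ᵇ rank π (vertex φ q)) ≡ (place t p <ᵇ place t q)
      rank-<ᵇ p q with <-cmp (place t p) (place t q)
      ... | tri< a _ _ = trans (<ᵇ-true (rank-mono a)) (sym (<ᵇ-true a))
      ... | tri≈ _ e _ rewrite place-injective t {p} {q} e = trans (<ᵇ-false {rank π (vertex φ q)} ≤-refl) (sym (<ᵇ-false {place t q} ≤-refl))
      ... | tri> _ _ a = trans (<ᵇ-false (<⇒≤ (rank-mono a))) (sym (<ᵇ-false (<⇒≤ a)))

      -- The two twin edges together cover the whole unit, and `π` sorts the unit as its template
      -- does, so the vertices before a given one fill exactly the earlier positions of the
      -- sequence.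
      pos≡place : ∀ x y → (∀ c → carries x c ≡ true ⊎ carries y c ≡ true) → ∀ q →
        pos π (edgeOf (φ , x) ∪ edgeOf (φ , y)) (vertex φ q) ≡ place t q
      pos≡place x y cover q = begin
        pos π (edgeOf (φ , x) ∪ edgeOf (φ , y)) (vertex φ q)
          ≡⟨ pos≡cnt π φ _ (λ _ → true) to (λ p _ → x∈p∪q⁺ (from (cover (lab p)))) q ⟩
        cnt (λ p → (rank π (vertex φ p) <ᵇ rank π (vertex φ q)) ∧ true)
          ≡⟨ cnt-cong (λ p → trans (∧-identityʳ _) (rank-<ᵇ p q)) ⟩
        cnt (λ p → place t p <ᵇ place t q)
          ≡⟨ cnt-permute (λ (i : Fin (length (seq j))) → toℕ i <ᵇ place t q) (perm t) ⟩
        cnt (λ (i : Fin (length (seq j))) → toℕ i <ᵇ place t q)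
          ≡⟨ cnt-<ᵇ (perm t ⟨$⟩ʳ q) ⟩
        place t q ∎
        where
        open ≡-Reasoning
        to : ∀ {w} → w ∈ edgeOf (φ , x) ∪ edgeOf (φ , y) → ∃ λ p → true ≡ true × vertex φ p ≡ w
        to w∈ with x∈p∪q⁻ (edgeOf (φ , x)) _ w∈
        ... | inj₁ w∈e = let p , _ , e = ∈-edge⁻ w∈e in p , refl , e
        ... | inj₂ w∈f = let p , _ , e = ∈-edge⁻ w∈f in p , refl , e
        from : ∀ {p} → carries x (lab p) ≡ true ⊎ carries y (lab p) ≡ true →
          vertex φ p ∈ edgeOf (φ , x) ⊎ vertex φ p ∈ edgeOf (φ , y)
        from (inj₁ c) = inj₁ (∈-edge⁺ c)
        from (inj₂ c) = inj₂ (∈-edge⁺ c)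

      ∉-edge : ∀ {x p} → carries x (lab p) ≡ false → vertex φ p ∉ edgeOf (φ , x)
      ∉-edge c w∈ = contradiction (trans (sym c) (vertex∈edge⁻ w∈)) λ ()

      labelled : ∀ p → LabelOf (edgeOf (φ , zero)) (edgeOf (φ , suc zero)) (vertex φ p) (lab p)
      labelled p with lab p in eq
      ... | X = ∈-edge⁺ (cong isXZ eq) , ∉-edge (cong isYZ eq)
      ... | Y = ∉-edge (cong isXZ eq) , ∈-edge⁺ (cong isYZ eq)
      ... | Z = ∈-edge⁺ (cong isXZ eq) , ∈-edge⁺ (cong isYZ eq)

      LabelOf-swap : ∀ {e f : Subset ν} {w} c → LabelOf e f w c → LabelOf f e w (swapXY c)
      LabelOf-swap X (a , b) = b , a
      LabelOf-swap Y (a , b) = b , a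
      LabelOf-swap Z (a , b) = b , a

      vertex-of : ∀ {x y w} → w ∈ edgeOf (φ , x) ∪ edgeOf (φ , y) → ∃ λ p → vertex φ p ≡ w
      vertex-of {x} w∈ with x∈p∪q⁻ (edgeOf (φ , x)) _ w∈
      ... | inj₁ w∈e = let p , _ , e = ∈-edge⁻ w∈e in p , e
      ... | inj₂ w∈f = let p , _ , e = ∈-edge⁻ w∈f in p , e

      letter-at : ∀ x y → (∀ c → carries x c ≡ true ⊎ carries y c ≡ true) → ∀ p {c} → lookup (seq j) (perm t ⟨$⟩ʳ p) ≡ c →
        seq j !! pos π (edgeOf (φ , x) ∪ edgeOf (φ , y)) (vertex φ p) ≡ just c
      letter-at x y cover p e = trans (cong (seq j !!_) (pos≡place x y cover p)) (trans (!!-lookup (seq j) (perm t ⟨$⟩ʳ p)) (cong just e))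

      cover₀₁ : ∀ c → isXZ c ≡ true ⊎ isYZ c ≡ true
      cover₀₁ X = inj₁ refl
      cover₀₁ Y = inj₂ refl
      cover₀₁ Z = inj₁ refl

      cover₁₀ : ∀ c → isYZ c ≡ true ⊎ isXZ c ≡ true
      cover₁₀ X = inj₂ refl
      cover₁₀ Y = inj₁ refl
      cover₁₀ Z = inj₁ refl

      -- A template that exchanges X with Y describes the twins in the opposite order.
      described : Describes π (seq j) (edgeOf (φ , zero)) (edgeOf (φ , suc zero))
      described with letters t
      ... | inj₁ ok = inj₁ λ w w∈ → let p , e = vertex-of {zero} {suc zero} w∈ in subst (λ w → Σ Letter λ c →
          (seq j !! pos π (edgeOf (φ , zero) ∪ edgeOf (φ , suc zero)) w ≡ just c) × LabelOf (edgeOf (φ , zero)) (edgeOf (φ , suc zero)) w c) e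
        (lab p , letter-at zero (suc zero) cover₀₁ p (ok p) , labelled p)
      ... | inj₂ ok = inj₂ λ w w∈ → let p , e = vertex-of {suc zero} {zero} w∈ in subst (λ w → Σ Letter λ c →
          (seq j !! pos π (edgeOf (φ , suc zero) ∪ edgeOf (φ , zero)) w ≡ just c) × LabelOf (edgeOf (φ , suc zero)) (edgeOf (φ , zero)) w c) e
        (swapXY (lab p) , letter-at (suc zero) zero cover₁₀ p (ok p) , LabelOf-swap (lab p) (labelled p))

    swap-describes : ∀ {e f : Subset ν} → Describes π (seq j) e f → Describes π (seq j) f e
    swap-describes (inj₁ x) = inj₂ x
    swap-describes (inj₂ x) = inj₁ x

    twins-described : ∀ i j′ → i ≢ j′ → ∣ edgeOf i ∩ edgeOf j′ ∣ ≡ 2 → Describes π (seq j) (edgeOf i) (edgeOf j′)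
    twins-described i j′ i≢j′ ∣∩∣ with relation i j′
    ... | same = contradiction refl i≢j′
    ... | twins₀₁ φ = described φ
    ... | twins₁₀ φ = swap-describes (described φ)
    ... | stranger {x = x} {x′} φ≢φ′ = contradiction (subst (_≤ 1) ∣∩∣ (∣strangers∣ x x′ φ≢φ′)) λ { (s≤s ()) }

    F-admits : Admits F (seq j)
    F-admits = π , λ e f e≢f → twins-described (label e) (label f) (e≢f ∘ label-injective)

theorem3p4 : ∀ (r : ℕ) → 3 ≤ r → Σ (Hypergraph r) λ F →
    QuasiLinear F × Inconsistent F
    × (∀ (σ : List Letter) → DescriptiveSeq r σ → InconsistentSeq σ → Admits F σ)
theorem3p4 (suc (suc (suc m))) _ = F , F-quasiLinear , F-inconsistent , admits
  where
  open BlowUp m (baseSystem m)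
  admits : ∀ σ → DescriptiveSeq (3 + m) σ → InconsistentSeq σ → Admits F σ
  admits σ desc incons with Sequences.inconsistent⇒seq m σ desc incons
  ... | j , refl = F-admits j
theorem3p4 (suc zero)       (s≤s ())
theorem3p4 (suc (suc zero)) (s≤s (s≤s ()))
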